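{- Let $R$ be a finite Frobenius ring and let $\psi$ be a primitive additive character of $R$. Let $a,b\in R$. For each principal ideal $D$ of $R$ with $(a)\subseteq D$ and $(b)\subseteq D$, choose a generator $d$ of $D$ and elements $a_0,b_0\in R$ with $a=da_0$, $b=db_0$, and define $$T_D=\sum_{v\in (R/d^\perp)^\times}\psi\big(d\tilde v\big)\,\psi\big(d\,a_0b_0\,\tilde v^{ -1}\big)$$ if $d\neq 0$, where $\tilde v\in R^\times$ is any lift of $v$ (so the summand is $K(d.\psi,(a_0b_0).(d.\psi))$ computed over the quotient ring $R/d^\perp$, on which $d.\psi$ is a well-defined primitive character), and $T_D=1$ if $D=(0)$ (this case only occurs when $a=b=0$; it corresponds to the Kloosterman sum over the zero ring). Then $T_D$ and $|d^\perp|$ do not depend on the choices made, and $$\sum_{u\in R^\times}\psi(au+bu^{ -1})=\sum_{\substack{D=(d)\text{ principal}\\ (a),(b)\subseteq D}} |d^\perp|\;T_D .$$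
   Context: All rings are finite and commutative with identity; $R^\times$ denotes the unit group. An additive character of $R$ is a group homomorphism $(R,+)\to\mathbb{C}^*$; for $c\in R$ and an additive character $\psi$, $c.\psi$ denotes the character $r\mapsto\psi(cr)$. The conductor of an additive character is the largest ideal on which it is identically $1$; a character is primitive if its conductor is the zero ideal. $R$ is called Frobenius if it admits a primitive additive character. For an ideal $I$ (or element $d$), $I^\perp=\{r\in R: rx=0\ \forall x\in I\}$ and $d^\perp=(d)^\perp$. For additive characters $\phi,\psi$ of a finite ring $S$, the Kloosterman sum is $K(\phi,\psi)=\sum_{u\in S^\times}\phi(u)\psi(u^{ -1})$. -}

module Defs where

open import Algebra.Bundles using (AbelianGroup; CommutativeRing; Group)
import Algebra.Morphism.Construct.Composition as Composition
open import Algebra.Morphism.Structures using (module GroupMorphisms)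
import Algebra.Definitions.RawMonoid as RawMonoidDefinitions
import Algebra.Properties.AbelianGroup as AbelianGroupProperties
import Algebra.Properties.CommutativeSemigroup as CommutativeSemigroupProperties
import Algebra.Properties.Ring as RingProperties
import Algebra.Solver.Ring.NaturalCoefficients.Default as SemiringSolver
open import Data.Bool.Base using (if_then_else_)
open import Data.Fin.Base using (Fin; zero; suc)
open import Data.Fin.Properties using (any?)
import Data.Fin.Properties as Fin
open import Data.List.Base as List using (List; []; _∷_; length; lookup)
import Data.List.Membership.Setoid.Properties as Membership
open import Data.List.Relation.Unary.All as All using (All)
open import Data.List.Relation.Unary.AllPairs.Core using ([]; _∷_)
open import Data.List.Relation.Unary.Any as Any using (index)
open import Data.List.Relation.Unary.Any.Properties using (lookup-index)
import Data.List.Relation.Unary.Enumerates.Setoid.Properties as Enumerates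
open import Data.List.Relation.Unary.Unique.Setoid using (Unique)
open import Data.List.Relation.Unary.Unique.DecSetoid.Properties using (deduplicate-!)
open import Data.Nat.Base as ℕ using (ℕ)
import Data.Nat.Properties as ℕ
open import Data.Product.Base using (_×_; _,_; proj₁; proj₂; ∃; Σ-syntax; ∃-syntax)
open import Data.Rational.Base as ℚ using (ℚ; 0ℚ; 1ℚ; ½; ∣_∣)
import Data.Rational.Properties as ℚ
open import Data.Rational.Solver using (module +-*-Solver)
open import Function.Base using (_∘_)
open import Function.Bundles using (Inverse)
open import Level using (Level; 0ℓ; _⊔_) renaming (suc to lsuc)
open import Relation.Binary.Bundles using (Setoid; DecSetoid)
open import Relation.Binary.Definitions using (Decidable)
open import Relation.Binary.PropositionalEquality as ≡ using (_≡_)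
import Relation.Binary.Reasoning.Setoid as SetoidReasoning
open import Relation.Nullary using (Dec; does; yes; no; contradiction)
open import Relation.Nullary.Decidable using (map′; _×-dec_)
open import Relation.Unary using (Pred; _⊆_; _≐_)
import Relation.Unary as Unary

private
  variable
    a b c ℓ ℓ′ : Level

record Finite (S : Setoid a ℓ) : Set (a ⊔ ℓ) where
  field
    size        : ℕ
    enumeration : Inverse (≡.setoid (Fin size)) S

  open Setoid S
  open Inverse enumeration public
    using () renaming (to to element; from to position)

  element-position : ∀ x → element (position x) ≈ x
  element-position x = Inverse.inverseˡ enumeration ≡.refl

  infix 4 _≟_
  _≟_ : Decidable _≈_
  x ≟ y = map′
    (λ eq → trans (sym (element-position x))
              (trans (reflexive (≡.cong element eq)) (element-position y)))
    (Inverse.from-cong enumeration)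
    (position x Fin.≟ position y)

  ∃? : ∀ {p} {P : Pred Carrier p} → (∀ {x y} → x ≈ y → P x → P y) →
       Unary.Decidable P → Dec (∃ P)
  ∃? resp P? = map′
    (λ (i , p) → element i , p)
    (λ (x , p) → position x , resp (sym (element-position x)) p)
    (any? (P? ∘ element))

module _ (S : Setoid a ℓ) where
  open Setoid S

  private
    lookup-injective : ∀ {xs} → Unique S xs → ∀ {i j} →
                       lookup xs i ≈ lookup xs j → i ≡ j
    lookup-injective {_ ∷ _} (_ ∷ _)  {zero}  {zero}  _  = ≡.refl
    lookup-injective {_ ∷ xs} (p ∷ _) {zero}  {suc j} eq =
      contradiction eq (All.lookupWith (λ ¬eq eq′ e → ¬eq (trans e eq′)) p
        (Membership.∈-lookup S xs j))
    lookup-injective {_ ∷ xs} (p ∷ _) {suc i} {zero}  eq =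
      contradiction (sym eq) (All.lookupWith (λ ¬eq eq′ e → ¬eq (trans e eq′)) p
        (Membership.∈-lookup S xs i))
    lookup-injective {_ ∷ _} (_ ∷ ps) {suc i} {suc j} eq =
      ≡.cong suc (lookup-injective ps eq)

  -- A setoid with decidable equality which is covered by the values
  -- f 0, …, f (n - 1), possibly with repetitions, is finite.
  finite-cover : Decidable _≈_ → ∀ {n} (f : Fin n → Carrier) →
                 (∀ x → ∃ λ i → f i ≈ x) → Finite S
  finite-cover dec f covers = record
    { size        = length xs
    ; enumeration = record
      { to        = lookup xs
      ; from      = λ x → index (all x)
      ; to-cong   = λ { ≡.refl → refl }
      ; from-cong = λ {x} {y} x≈y → lookup-injective unique
          (trans (sym (lookup-index (all x))) (trans x≈y (lookup-index (all y))))
      ; inverse   = (λ { {x} ≡.refl → sym (lookup-index (all x)) })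
                  , (λ {i} {x} x≈ → lookup-injective unique
                      (trans (sym (lookup-index (all x))) x≈))
      }
    }
    where
    D : DecSetoid a ℓ
    D = record { isDecEquivalence = record { isEquivalence = isEquivalence ; _≟_ = dec } }

    open import Data.List.Membership.Setoid S using (_∈_)

    xs : List Carrier
    xs = List.deduplicate dec (List.tabulate f)

    unique : Unique S xs
    unique = deduplicate-! D (List.tabulate f)

    all : ∀ x → x ∈ xs
    all = Enumerates.deduplicate⁺ D λ x →
      Membership.∈-resp-≈ S (proj₂ (covers x)) (Membership.∈-tabulate⁺ S (proj₁ (covers x)))

-- The level c ⊔ ℓ of the membership predicate is that of principal ideals and
-- of annihilators.  In a finite ring nothing is lost: up to excluded middle,
-- every subset is a decidable one and so exists at every level.
module _ (R : CommutativeRing c ℓ) where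
  open CommutativeRing R

  record Ideal : Set (lsuc (c ⊔ ℓ)) where
    field
      Member   : Pred Carrier (c ⊔ ℓ)
      resp     : ∀ {x y} → x ≈ y → Member x → Member y
      0-closed : Member 0#
      +-closed : ∀ {x y} → Member x → Member y → Member (x + y)
      *-closed : ∀ r {x} → Member x → Member (r * x)

open Ideal public using (Member)

module _ (R : CommutativeRing c ℓ) where
  open CommutativeRing R
  open RingProperties ring
  open AbelianGroupProperties +-abelianGroup using (⁻¹-∙-comm)
  open CommutativeSemigroupProperties +-commutativeSemigroup using (interchange)
  open SetoidReasoning setoid

  infixl 7 _/_
  _/_ : Ideal R → CommutativeRing c (c ⊔ ℓ)
  _/_ I = record
    { Carrier = Carrier
    ; _≈_ = _∼_
    ; _+_ = _+_
    ; _*_ = _*_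
    ; -_  = -_
    ; 0#  = 0#
    ; 1#  = 1#
    ; isCommutativeRing = record
      { isRing = record
        { +-isAbelianGroup = record
          { isGroup = record
            { isMonoid = record
              { isSemigroup = record
                { isMagma = record
                  { isEquivalence = record
                    { refl = ≈⇒∼ refl ; sym = ∼-sym ; trans = ∼-trans }
                  ; ∙-cong = ∼-+-cong
                  }
                ; assoc = λ x y z → ≈⇒∼ (+-assoc x y z)
                }
              ; identity = ≈⇒∼ ∘ +-identityˡ , ≈⇒∼ ∘ +-identityʳ
              }
            ; inverse = ≈⇒∼ ∘ -‿inverseˡ , ≈⇒∼ ∘ -‿inverseʳ
            ; ⁻¹-cong = ∼-neg-cong
            }
          ; comm = λ x y → ≈⇒∼ (+-comm x y)
          }
        ; *-cong     = ∼-*-cong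
        ; *-assoc    = λ x y z → ≈⇒∼ (*-assoc x y z)
        ; *-identity = ≈⇒∼ ∘ *-identityˡ , ≈⇒∼ ∘ *-identityʳ
        ; distrib    = (λ x y z → ≈⇒∼ (distribˡ x y z)) , (λ x y z → ≈⇒∼ (distribʳ x y z))
        }
      ; *-comm = λ x y → ≈⇒∼ (*-comm x y)
      }
    }
    where
    open Ideal I using (resp; 0-closed; +-closed; *-closed)

    infix 4 _∼_
    _∼_ : Carrier → Carrier → Set (c ⊔ ℓ)
    x ∼ y = Member I (x - y)

    ≈⇒∼ : ∀ {x y} → x ≈ y → x ∼ y
    ≈⇒∼ {x} {y} x≈y = resp (sym (trans (+-congʳ x≈y) (-‿inverseʳ y))) 0-closed

    neg-closed : ∀ {x} → Member I x → Member I (- x)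
    neg-closed {x} p = resp (-1*x≈-x x) (*-closed (- 1#) p)

    neg-sub : ∀ x y → - (x - y) ≈ y - x
    neg-sub x y = begin
      - (x - y)       ≈⟨ ⁻¹-∙-comm x (- y) ⟨
      - x + (- (- y)) ≈⟨ +-congˡ (-‿involutive y) ⟩
      - x + y         ≈⟨ +-comm (- x) y ⟩
      y - x           ∎

    ∼-sym : ∀ {x y} → x ∼ y → y ∼ x
    ∼-sym {x} {y} p = resp (neg-sub x y) (neg-closed p)

    ∼-trans : ∀ {x y z} → x ∼ y → y ∼ z → x ∼ z
    ∼-trans {x} {y} {z} p q = resp eq (+-closed p q)
      where
      eq : (x - y) + (y - z) ≈ x - z
      eq = begin
        (x - y) + (y - z)     ≈⟨ +-assoc x (- y) (y - z) ⟩
        x + (- y + (y - z))   ≈⟨ +-congˡ (+-assoc (- y) y (- z)) ⟨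
        x + ((- y + y) - z)   ≈⟨ +-congˡ (+-congʳ (-‿inverseˡ y)) ⟩
        x + (0# - z)          ≈⟨ +-congˡ (+-identityˡ (- z)) ⟩
        x - z                 ∎

    ∼-+-cong : ∀ {x y u v} → x ∼ y → u ∼ v → x + u ∼ y + v
    ∼-+-cong {x} {y} {u} {v} p q = resp
      (trans (interchange x (- y) u (- v)) (+-congˡ (⁻¹-∙-comm y v)))
      (+-closed p q)

    ∼-neg-cong : ∀ {x y} → x ∼ y → - x ∼ - y
    ∼-neg-cong {x} {y} p = resp (sym (⁻¹-∙-comm x (- y))) (neg-closed p)

    *-sub : ∀ x y z → x * (y - z) ≈ x * y - x * z
    *-sub x y z = trans (distribˡ x y (- z)) (+-congˡ (sym (-‿distribʳ-* x z)))

    ∼-*-cong : ∀ {x y u v} → x ∼ y → u ∼ v → x * u ∼ y * v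
    ∼-*-cong {x} {y} {u} {v} p q = ∼-trans
      (resp (trans (*-sub u x y) (+-cong (*-comm u x) (-‿cong (*-comm u y)))) (*-closed u p))
      (resp (*-sub y u v) (*-closed y q))

record Unit (R : CommutativeRing c ℓ) : Set (c ⊔ ℓ) where
  constructor unit
  open CommutativeRing R
  field
    value     : Carrier
    inverse   : Carrier
    isInverse : value * inverse ≈ 1#

open Unit public using (value; inverse)

module _ (R : CommutativeRing c ℓ) where
  open CommutativeRing R
  open SetoidReasoning setoid
  open CommutativeSemigroupProperties *-commutativeSemigroup using (interchange)

  unitGroup : AbelianGroup (c ⊔ ℓ) ℓ
  unitGroup = record
    { Carrier = Unit R
    ; _≈_ = λ u v → value u ≈ value v
    ; _∙_ = λ (unit u u⁻¹ p) (unit v v⁻¹ q) → unit (u * v) (u⁻¹ * v⁻¹)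
        (trans (interchange u v u⁻¹ v⁻¹) (trans (*-cong p q) (*-identityˡ 1#)))
    ; ε   = unit 1# 1# (*-identityˡ 1#)
    ; _⁻¹ = λ (unit u u⁻¹ p) → unit u⁻¹ u (trans (*-comm u⁻¹ u) p)
    ; isAbelianGroup = record
      { isGroup = record
        { isMonoid = record
          { isSemigroup = record
            { isMagma = record
              { isEquivalence = record { refl = refl ; sym = sym ; trans = trans }
              ; ∙-cong = *-cong
              }
            ; assoc = λ u v w → *-assoc (value u) (value v) (value w)
            }
          ; identity = *-identityˡ ∘ value , *-identityʳ ∘ value
          }
        ; inverse = (λ (unit u u⁻¹ p) → trans (*-comm u⁻¹ u) p) , Unit.isInverse
        ; ⁻¹-cong = λ {u} {v} → inverse-cong u v
        }
      ; comm = λ u v → *-comm (value u) (value v)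
      }
    }
    where
    inverse-cong : (u v : Unit R) → value u ≈ value v → inverse u ≈ inverse v
    inverse-cong (unit u u⁻¹ p) (unit v v⁻¹ q) u≈v = begin
      u⁻¹               ≈⟨ *-identityʳ u⁻¹ ⟨
      u⁻¹ * 1#          ≈⟨ *-congˡ q ⟨
      u⁻¹ * (v * v⁻¹)   ≈⟨ *-congˡ (*-congʳ u≈v) ⟨
      u⁻¹ * (u * v⁻¹)   ≈⟨ *-assoc u⁻¹ u v⁻¹ ⟨
      u⁻¹ * u * v⁻¹     ≈⟨ *-congʳ (trans (*-comm u⁻¹ u) p) ⟩
      1# * v⁻¹          ≈⟨ *-identityˡ v⁻¹ ⟩
      v⁻¹               ∎

  unitSetoid : Setoid (c ⊔ ℓ) ℓ
  unitSetoid = AbelianGroup.setoid unitGroup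

  unitsFinite : Finite setoid → Finite unitSetoid
  unitsFinite fin = finite-cover unitSetoid (λ u v → value u ≟ value v) (toUnit ∘ element) covers
    where
    open Finite fin

    invertible? : ∀ x → Dec (∃ λ y → x * y ≈ 1#)
    invertible? x = ∃? (λ y≈z → trans (*-congˡ (sym y≈z))) (λ y → x * y ≟ 1#)

    toUnit : Carrier → Unit R
    toUnit x with invertible? x
    ... | yes (y , p) = unit x y p
    ... | no _        = AbelianGroup.ε unitGroup

    value-toUnit : ∀ u x → x ≈ value u → value (toUnit x) ≈ value u
    value-toUnit u x x≈u with invertible? x
    ... | yes _ = x≈u
    ... | no ¬p = contradiction (inverse u , trans (*-congʳ x≈u) (Unit.isInverse u)) ¬p

    covers : ∀ u → ∃ λ i → value (toUnit (element i)) ≈ value u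
    covers u = position (value u) ,
               value-toUnit u (element (position (value u))) (element-position (value u))

Cauchy : (ℕ → ℚ) → Set
Cauchy x = ∀ ε → 0ℚ ℚ.< ε →
  ∃[ N ] (∀ m n → N ℕ.≤ m → N ℕ.≤ n → ∣ x m ℚ.- x n ∣ ℚ.< ε)

Null : (ℕ → ℚ) → Set
Null x = ∀ ε → 0ℚ ℚ.< ε → ∃[ N ] (∀ n → N ℕ.≤ n → ∣ x n ∣ ℚ.< ε)

private
  half : ∀ {ε} → 0ℚ ℚ.< ε → 0ℚ ℚ.< ε ℚ.* ½
  half {ε} 0<ε = ≡.subst (ℚ._< ε ℚ.* ½) (ℚ.*-zeroˡ ½) (ℚ.*-monoˡ-<-pos ½ 0<ε)

  halves : ∀ ε → ε ℚ.* ½ ℚ.+ ε ℚ.* ½ ≡ ε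
  halves ε = ≡.trans (≡.sym (ℚ.*-distribˡ-+ ε ½ ½)) (ℚ.*-identityʳ ε)

  scale : ∀ {B ε} → 0ℚ ℚ.< B → 0ℚ ℚ.< ε → ∃[ δ ] (0ℚ ℚ.< δ × B ℚ.* δ ≡ ε)
  scale {B} {ε} 0<B 0<ε = (1/B ℚ.* ε) , 0<δ , eq
    where
    instance
      B-pos : ℚ.Positive B
      B-pos = ℚ.positive 0<B
      B-nonZero : ℚ.NonZero B
      B-nonZero = ℚ.pos⇒nonZero B
      ε-pos : ℚ.Positive ε
      ε-pos = ℚ.positive 0<ε
    1/B : ℚ
    1/B = ℚ.1/ B
    0<δ : 0ℚ ℚ.< 1/B ℚ.* ε
    0<δ = ℚ.positive⁻¹ (1/B ℚ.* ε) {{ℚ.pos*pos⇒pos 1/B {{ℚ.1/pos⇒pos B}} ε}}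
    eq : B ℚ.* (1/B ℚ.* ε) ≡ ε
    eq = ≡.trans (≡.sym (ℚ.*-assoc B 1/B ε))
           (≡.trans (≡.cong (ℚ._* ε) (ℚ.*-inverseʳ B)) (ℚ.*-identityˡ ε))

  add-< : ∀ {p q δ ε} → ∣ p ∣ ℚ.< δ → ∣ q ∣ ℚ.< ε → ∣ p ℚ.+ q ∣ ℚ.< δ ℚ.+ ε
  add-< {p} {q} p< q< = ℚ.≤-<-trans (ℚ.∣p+q∣≤∣p∣+∣q∣ p q) (ℚ.+-mono-< p< q<)

  mul-< : ∀ {p q B δ} → ∣ p ∣ ℚ.< B → ∣ q ∣ ℚ.< δ → ∣ p ℚ.* q ∣ ℚ.< B ℚ.* δ
  mul-< {p} {q} {B} {δ} p< q< = ≡.subst (ℚ._< B ℚ.* δ) (≡.sym (ℚ.∣p*q∣≡∣p∣*∣q∣ p q))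
    (ℚ.≤-<-trans
      (ℚ.*-monoʳ-≤-nonNeg ∣ q ∣ {{ℚ.∣-∣-nonNeg q}} (ℚ.<⇒≤ p<))
      (ℚ.*-monoʳ-<-pos B {{ℚ.positive (ℚ.≤-<-trans (ℚ.0≤∣p∣ p) p<)}} q<))

  bounded : ∀ {x} → Cauchy x →
            ∃[ B ] (0ℚ ℚ.< B × ∃[ N ] (∀ n → N ℕ.≤ n → ∣ x n ∣ ℚ.< B))
  bounded {x} cauchy with cauchy 1ℚ (ℚ.positive⁻¹ 1ℚ)
  ... | N , close = B , ℚ.≤-<-trans (ℚ.0≤∣p∣ (x N)) (bound N ℕ.≤-refl) , N , bound
    where
    B : ℚ
    B = 1ℚ ℚ.+ ∣ x N ∣
    rearrange : ∀ p q → (p ℚ.- q) ℚ.+ q ≡ p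
    rearrange = +-*-Solver.solve 2 (λ p q → (p :+ :- q) :+ q := p) ≡.refl
      where open +-*-Solver
    bound : ∀ n → N ℕ.≤ n → ∣ x n ∣ ℚ.< B
    bound n N≤n = ≡.subst (λ p → ∣ p ∣ ℚ.< B) (rearrange (x n) (x N))
      (ℚ.≤-<-trans (ℚ.∣p+q∣≤∣p∣+∣q∣ (x n ℚ.- x N) (x N))
        (ℚ.+-monoˡ-< ∣ x N ∣ (close n N N≤n ℕ.≤-refl)))

  const-cauchy : ∀ q → Cauchy (λ _ → q)
  const-cauchy q ε 0<ε = 0 , λ _ _ _ _ →
    ≡.subst (λ p → ∣ p ∣ ℚ.< ε) (≡.sym (ℚ.+-inverseʳ q)) 0<ε

  +-cauchy : ∀ {x y} → Cauchy x → Cauchy y → Cauchy (λ n → x n ℚ.+ y n)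
  +-cauchy {x} {y} cx cy ε 0<ε with cx (ε ℚ.* ½) (half 0<ε) | cy (ε ℚ.* ½) (half 0<ε)
  ... | M , p | N , q = M ℕ.⊔ N , λ m n ≤m ≤n →
    ≡.subst₂ (λ u v → ∣ u ∣ ℚ.< v) (rearrange (x m) (x n) (y m) (y n)) (halves ε)
      (add-< (p m n (ℕ.m⊔n≤o⇒m≤o M N ≤m) (ℕ.m⊔n≤o⇒m≤o M N ≤n))
             (q m n (ℕ.m⊔n≤o⇒n≤o M N ≤m) (ℕ.m⊔n≤o⇒n≤o M N ≤n)))
    where
    rearrange : ∀ p q r s → (p ℚ.- q) ℚ.+ (r ℚ.- s) ≡ (p ℚ.+ r) ℚ.- (q ℚ.+ s)
    rearrange = +-*-Solver.solve 4
      (λ p q r s → (p :+ :- q) :+ (r :+ :- s) := (p :+ r) :+ :- (q :+ s)) ≡.refl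
      where open +-*-Solver

  neg-cauchy : ∀ {x} → Cauchy x → Cauchy (λ n → ℚ.- x n)
  neg-cauchy {x} cx ε 0<ε with cx ε 0<ε
  ... | N , p = N , λ m n ≤m ≤n →
    ≡.subst (ℚ._< ε) (≡.trans (≡.sym (ℚ.∣-p∣≡∣p∣ (x m ℚ.- x n)))
        (≡.cong ∣_∣ (ℚ.neg-distrib-+ (x m) (ℚ.- x n)))) (p m n ≤m ≤n)

  *-cauchy : ∀ {x y} → Cauchy x → Cauchy y → Cauchy (λ n → x n ℚ.* y n)
  *-cauchy {x} {y} cx cy ε 0<ε =
    let B , 0<B , M₁ , x< = bounded cx
        C , 0<C , M₂ , y< = bounded cy
        δ , 0<δ , Bδ = scale 0<B (half 0<ε)
        γ , 0<γ , Cγ = scale 0<C (half 0<ε)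
        M₃ , p = cy δ 0<δ
        M₄ , q = cx γ 0<γ
        M₁₂ = M₁ ℕ.⊔ M₂
        M₃₄ = M₃ ℕ.⊔ M₄
        ≥M₁ = λ {n} (h : M₁₂ ℕ.⊔ M₃₄ ℕ.≤ n) → ℕ.m⊔n≤o⇒m≤o M₁ M₂ (ℕ.m⊔n≤o⇒m≤o M₁₂ M₃₄ h)
        ≥M₂ = λ {n} (h : M₁₂ ℕ.⊔ M₃₄ ℕ.≤ n) → ℕ.m⊔n≤o⇒n≤o M₁ M₂ (ℕ.m⊔n≤o⇒m≤o M₁₂ M₃₄ h)
        ≥M₃ = λ {n} (h : M₁₂ ℕ.⊔ M₃₄ ℕ.≤ n) → ℕ.m⊔n≤o⇒m≤o M₃ M₄ (ℕ.m⊔n≤o⇒n≤o M₁₂ M₃₄ h)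
        ≥M₄ = λ {n} (h : M₁₂ ℕ.⊔ M₃₄ ℕ.≤ n) → ℕ.m⊔n≤o⇒n≤o M₃ M₄ (ℕ.m⊔n≤o⇒n≤o M₁₂ M₃₄ h)
    in M₁₂ ℕ.⊔ M₃₄ , λ m n ≤m ≤n →
      ≡.subst₂ (λ u v → ∣ u ∣ ℚ.< v) (rearrange (x m) (x n) (y m) (y n))
        (≡.trans (≡.cong₂ ℚ._+_ Bδ Cγ) (halves ε))
        (add-< {x m ℚ.* (y m ℚ.- y n)} {y n ℚ.* (x m ℚ.- x n)} {B ℚ.* δ} {C ℚ.* γ}
          (mul-< {x m} {y m ℚ.- y n} (x< m (≥M₁ ≤m)) (p m n (≥M₃ ≤m) (≥M₃ ≤n)))
          (mul-< {y n} {x m ℚ.- x n} (y< n (≥M₂ ≤n)) (q m n (≥M₄ ≤m) (≥M₄ ≤n))))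
    where
    rearrange : ∀ p q r s → p ℚ.* (r ℚ.- s) ℚ.+ s ℚ.* (p ℚ.- q) ≡ p ℚ.* r ℚ.- q ℚ.* s
    rearrange = +-*-Solver.solve 4
      (λ p q r s → p :* (r :+ :- s) :+ s :* (p :+ :- q) := p :* r :+ :- (q :* s)) ≡.refl
      where open +-*-Solver

  +-null : ∀ {x y} → Null x → Null y → Null (λ n → x n ℚ.+ y n)
  +-null {x} {y} nx ny ε 0<ε with nx (ε ℚ.* ½) (half 0<ε) | ny (ε ℚ.* ½) (half 0<ε)
  ... | M , p | N , q = M ℕ.⊔ N , λ n ≤n →
    ≡.subst (∣ x n ℚ.+ y n ∣ ℚ.<_) (halves ε)
      (add-< (p n (ℕ.m⊔n≤o⇒m≤o M N ≤n)) (q n (ℕ.m⊔n≤o⇒n≤o M N ≤n)))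

  *-null : ∀ {x y} → Cauchy x → Null y → Null (λ n → x n ℚ.* y n)
  *-null {x} {y} cx ny ε 0<ε =
    let B , 0<B , M , x< = bounded cx
        δ , 0<δ , Bδ = scale 0<B 0<ε
        N , y< = ny δ 0<δ
    in M ℕ.⊔ N , λ n ≤n →
      ≡.subst (∣ x n ℚ.* y n ∣ ℚ.<_) Bδ
        (mul-< {x n} {y n} (x< n (ℕ.m⊔n≤o⇒m≤o M N ≤n)) (y< n (ℕ.m⊔n≤o⇒n≤o M N ≤n)))

-- Equality here is pointwise; it becomes equality of real numbers only in the
-- quotient ℝ by the null sequences.
cauchyRing : CommutativeRing 0ℓ 0ℓ
cauchyRing = record
  { Carrier = ∃ Cauchy
  ; _≈_ = λ x y → ∀ n → proj₁ x n ≡ proj₁ y n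
  ; _+_ = λ (x , cx) (y , cy) → (λ n → x n ℚ.+ y n) , +-cauchy {x} {y} cx cy
  ; _*_ = λ (x , cx) (y , cy) → (λ n → x n ℚ.* y n) , *-cauchy {x} {y} cx cy
  ; -_  = λ (x , cx) → (λ n → ℚ.- x n) , neg-cauchy {x} cx
  ; 0#  = (λ _ → 0ℚ) , const-cauchy 0ℚ
  ; 1#  = (λ _ → 1ℚ) , const-cauchy 1ℚ
  ; isCommutativeRing = record
    { isRing = record
      { +-isAbelianGroup = record
        { isGroup = record
          { isMonoid = record
            { isSemigroup = record
              { isMagma = record
                { isEquivalence = record
                  { refl  = λ _ → ≡.refl
                  ; sym   = λ p n → ≡.sym (p n)
                  ; trans = λ p q n → ≡.trans (p n) (q n)
                  }
                ; ∙-cong = λ p q n → ≡.cong₂ ℚ._+_ (p n) (q n)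
                }
              ; assoc = λ (x , _) (y , _) (z , _) n → ℚ.+-assoc (x n) (y n) (z n)
              }
            ; identity = (λ (x , _) n → ℚ.+-identityˡ (x n))
                       , (λ (x , _) n → ℚ.+-identityʳ (x n))
            }
          ; inverse = (λ (x , _) n → ℚ.+-inverseˡ (x n))
                    , (λ (x , _) n → ℚ.+-inverseʳ (x n))
          ; ⁻¹-cong = λ p n → ≡.cong ℚ.-_ (p n)
          }
        ; comm = λ (x , _) (y , _) n → ℚ.+-comm (x n) (y n)
        }
      ; *-cong     = λ p q n → ≡.cong₂ ℚ._*_ (p n) (q n)
      ; *-assoc    = λ (x , _) (y , _) (z , _) n → ℚ.*-assoc (x n) (y n) (z n)
      ; *-identity = (λ (x , _) n → ℚ.*-identityˡ (x n))
                   , (λ (x , _) n → ℚ.*-identityʳ (x n))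
      ; distrib    = (λ (x , _) (y , _) (z , _) n → ℚ.*-distribˡ-+ (x n) (y n) (z n))
                   , (λ (x , _) (y , _) (z , _) n → ℚ.*-distribʳ-+ (x n) (y n) (z n))
      }
    ; *-comm = λ (x , _) (y , _) n → ℚ.*-comm (x n) (y n)
    }
  }

nullIdeal : Ideal cauchyRing
nullIdeal = record
  { Member   = λ (x , _) → Null x
  ; resp     = λ x≈y null ε 0<ε → let N , p = null ε 0<ε in
                 N , λ n ≤n → ≡.subst (λ q → ∣ q ∣ ℚ.< ε) (x≈y n) (p n ≤n)
  ; 0-closed = λ ε 0<ε → 0 , λ _ _ → 0<ε
  ; +-closed = λ {(x , _)} {(y , _)} nx ny → +-null {x} {y} nx ny
  ; *-closed = λ (x , cx) {(y , _)} ny → *-null {x} {y} cx ny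
  }

ℝ : CommutativeRing 0ℓ 0ℓ
ℝ = cauchyRing / nullIdeal

module _ (R : CommutativeRing c ℓ) where
  open CommutativeRing R
  open RingProperties ring
  open SemiringSolver commutativeSemiring
  open SetoidReasoning setoid

  private
    -- Writing x - y as x + m * y with m = - 1# reduces the laws below to
    -- identities of commutative semirings in which m is a variable.
    m : Carrier
    m = - 1#

    sub : ∀ x y → x - y ≈ x + m * y
    sub x y = +-congˡ (sym (-1*x≈-x y))

    assoc-re : ∀ a b c d e f → (a * c - b * d) * e - (a * d + b * c) * f
                             ≈ a * (c * e - d * f) - b * (c * f + d * e)
    assoc-re a b c d e f = begin
      (a * c - b * d) * e - (a * d + b * c) * f
        ≈⟨ trans (sub _ _) (+-congʳ (*-congʳ (sub _ _))) ⟩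
      (a * c + m * (b * d)) * e + m * ((a * d + b * c) * f)
        ≈⟨ solve 7 (λ a b c d e f m →
             (a :* c :+ m :* (b :* d)) :* e :+ m :* ((a :* d :+ b :* c) :* f) :=
             a :* (c :* e :+ m :* (d :* f)) :+ m :* (b :* (c :* f :+ d :* e)))
             refl a b c d e f m ⟩
      a * (c * e + m * (d * f)) + m * (b * (c * f + d * e))
        ≈⟨ trans (sub _ _) (+-congʳ (*-congˡ (sub _ _))) ⟨
      a * (c * e - d * f) - b * (c * f + d * e) ∎

    assoc-im : ∀ a b c d e f → (a * c - b * d) * f + (a * d + b * c) * e
                             ≈ a * (c * f + d * e) + b * (c * e - d * f)
    assoc-im a b c d e f = begin
      (a * c - b * d) * f + (a * d + b * c) * e
        ≈⟨ +-congʳ (*-congʳ (sub _ _)) ⟩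
      (a * c + m * (b * d)) * f + (a * d + b * c) * e
        ≈⟨ solve 7 (λ a b c d e f m →
             (a :* c :+ m :* (b :* d)) :* f :+ (a :* d :+ b :* c) :* e :=
             a :* (c :* f :+ d :* e) :+ b :* (c :* e :+ m :* (d :* f)))
             refl a b c d e f m ⟩
      a * (c * f + d * e) + b * (c * e + m * (d * f))
        ≈⟨ +-congˡ (*-congˡ (sub _ _)) ⟨
      a * (c * f + d * e) + b * (c * e - d * f) ∎

    distribˡ-re : ∀ a b c d e f → a * (c + e) - b * (d + f)
                                ≈ (a * c - b * d) + (a * e - b * f)
    distribˡ-re a b c d e f = begin
      a * (c + e) - b * (d + f)
        ≈⟨ sub _ _ ⟩
      a * (c + e) + m * (b * (d + f))
        ≈⟨ solve 7 (λ a b c d e f m →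
             a :* (c :+ e) :+ m :* (b :* (d :+ f)) :=
             (a :* c :+ m :* (b :* d)) :+ (a :* e :+ m :* (b :* f)))
             refl a b c d e f m ⟩
      (a * c + m * (b * d)) + (a * e + m * (b * f))
        ≈⟨ +-cong (sub _ _) (sub _ _) ⟨
      (a * c - b * d) + (a * e - b * f) ∎

    distribˡ-im : ∀ a b c d e f → a * (d + f) + b * (c + e)
                                ≈ (a * d + b * c) + (a * f + b * e)
    distribˡ-im = solve 6 (λ a b c d e f →
      a :* (d :+ f) :+ b :* (c :+ e) := (a :* d :+ b :* c) :+ (a :* f :+ b :* e)) refl

    comm-im : ∀ a b c d → a * d + b * c ≈ c * b + d * a
    comm-im = solve 4 (λ a b c d → a :* d :+ b :* c := c :* b :+ d :* a) refl

    identity-re : ∀ a b → 1# * a - 0# * b ≈ a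
    identity-re a b = begin
      1# * a - 0# * b ≈⟨ +-cong (*-identityˡ a) (-‿cong (zeroˡ b)) ⟩
      a - 0#          ≈⟨ +-congˡ -0#≈0# ⟩
      a + 0#          ≈⟨ +-identityʳ a ⟩
      a               ∎

    identity-im : ∀ a b → 1# * b + 0# * a ≈ b
    identity-im = solve 2 (λ a b → con 1 :* b :+ con 0 :* a := b) refl

  -- R[i] with i² = -1; the pair (x , y) stands for x + y i.
  adjoin-i : CommutativeRing c ℓ
  adjoin-i = record
    { Carrier = Carrier × Carrier
    ; _≈_ = _≋_
    ; _+_ = λ (a , b) (c , d) → a + c , b + d
    ; _*_ = _⊛_
    ; -_  = λ (a , b) → - a , - b
    ; 0#  = 0# , 0#
    ; 1#  = one
    ; isCommutativeRing = record
      { isRing = record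
        { +-isAbelianGroup = record
          { isGroup = record
            { isMonoid = record
              { isSemigroup = record
                { isMagma = record
                  { isEquivalence = record
                    { refl  = refl , refl
                    ; sym   = λ (p , q) → sym p , sym q
                    ; trans = ≋-trans
                    }
                  ; ∙-cong = λ (p , q) (p′ , q′) → +-cong p p′ , +-cong q q′
                  }
                ; assoc = λ (a , b) (c , d) (e , f) → +-assoc a c e , +-assoc b d f
                }
              ; identity = (λ (a , b) → +-identityˡ a , +-identityˡ b)
                         , (λ (a , b) → +-identityʳ a , +-identityʳ b)
              }
            ; inverse = (λ (a , b) → -‿inverseˡ a , -‿inverseˡ b)
                      , (λ (a , b) → -‿inverseʳ a , -‿inverseʳ b)
            ; ⁻¹-cong = λ (p , q) → -‿cong p , -‿cong q
            }
          ; comm = λ (a , b) (c , d) → +-comm a c , +-comm b d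
          }
        ; *-cong     = λ (p , q) (p′ , q′) →
            +-cong (*-cong p p′) (-‿cong (*-cong q q′)) , +-cong (*-cong p q′) (*-cong q p′)
        ; *-assoc    = λ (a , b) (c , d) (e , f) →
            assoc-re a b c d e f , assoc-im a b c d e f
        ; *-identity = ⊛-identityˡ
                     , (λ z → ≋-trans (⊛-comm z one) (⊛-identityˡ z))
        ; distrib    = ⊛-distribˡ
                     , (λ z w v → ≋-trans (⊛-comm (add w v) z) (≋-trans (⊛-distribˡ z w v)
                         (add-cong (⊛-comm z w) (⊛-comm z v))))
        }
      ; *-comm = ⊛-comm
      }
    }
    where
    one : Carrier × Carrier
    one = 1# , 0#

    infix 4 _≋_
    _≋_ : Carrier × Carrier → Carrier × Carrier → Set ℓ
    (a , b) ≋ (c , d) = a ≈ c × b ≈ d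

    infixl 7 _⊛_
    add _⊛_ : Carrier × Carrier → Carrier × Carrier → Carrier × Carrier
    add (a , b) (c , d) = a + c , b + d
    (a , b) ⊛ (c , d) = a * c - b * d , a * d + b * c

    ≋-trans : ∀ {z w v} → z ≋ w → w ≋ v → z ≋ v
    ≋-trans (p , q) (p′ , q′) = trans p p′ , trans q q′

    add-cong : ∀ {z w z′ w′} → z ≋ z′ → w ≋ w′ → add z w ≋ add z′ w′
    add-cong (p , q) (p′ , q′) = +-cong p p′ , +-cong q q′

    ⊛-comm : ∀ z w → z ⊛ w ≋ w ⊛ z
    ⊛-comm (a , b) (c , d) = +-cong (*-comm a c) (-‿cong (*-comm b d)) , comm-im a b c d

    ⊛-identityˡ : ∀ z → one ⊛ z ≋ z
    ⊛-identityˡ (a , b) = identity-re a b , identity-im a b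

    ⊛-distribˡ : ∀ z w v → z ⊛ add w v ≋ add (z ⊛ w) (z ⊛ v)
    ⊛-distribˡ (a , b) (c , d) (e , f) = distribˡ-re a b c d e f , distribˡ-im a b c d e f

ℂ : CommutativeRing 0ℓ 0ℓ
ℂ = adjoin-i ℝ

module ℂ = CommutativeRing ℂ

open RawMonoidDefinitions ℂ.+-rawMonoid public using () renaming (_×_ to _·_)

∑ : {S : Setoid a ℓ} → Finite S → (Setoid.Carrier S → ℂ.Carrier) → ℂ.Carrier
∑ fin f = sum (f ∘ element)
  where
  open Finite fin using (element)
  open RawMonoidDefinitions ℂ.+-rawMonoid using (sum)

module _ (R : CommutativeRing c ℓ) where
  open CommutativeRing R
  open SetoidReasoning setoid
  open CommutativeSemigroupProperties *-commutativeSemigroup using (x∙yz≈y∙xz)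

  principal : Carrier → Ideal R
  principal d = record
    { Member   = λ r → ∃[ x ] r ≈ d * x
    ; resp     = λ r≈s (x , p) → x , trans (sym r≈s) p
    ; 0-closed = 0# , sym (zeroʳ d)
    ; +-closed = λ (x , p) (y , q) → x + y , trans (+-cong p q) (sym (distribˡ d x y))
    ; *-closed = λ r (x , p) → r * x , trans (*-congˡ p) (x∙yz≈y∙xz r d x)
    }

  annihilator : Ideal R → Ideal R
  annihilator I = record
    { Member   = λ r → ∀ x → Member I x → r * x ≈ 0#
    ; resp     = λ r≈s p x x∈I → trans (*-congʳ (sym r≈s)) (p x x∈I)
    ; 0-closed = λ x _ → zeroˡ x
    ; +-closed = λ {r} {s} p q x x∈I → begin
        (r + s) * x   ≈⟨ distribʳ x r s ⟩
        r * x + s * x ≈⟨ +-cong (p x x∈I) (q x x∈I) ⟩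
        0# + 0#       ≈⟨ +-identityˡ 0# ⟩
        0#            ∎
    ; *-closed = λ r {s} p x x∈I → begin
        r * s * x     ≈⟨ *-assoc r s x ⟩
        r * (s * x)   ≈⟨ *-congˡ (p x x∈I) ⟩
        r * 0#        ≈⟨ zeroʳ r ⟩
        0#            ∎
    }

  infix 8 _^⊥
  _^⊥ : Carrier → Ideal R
  d ^⊥ = annihilator (principal d)

  d∈principal : ∀ d → Member (principal d) d
  d∈principal d = 1# , sym (*-identityʳ d)

  principal-⊆ : ∀ (I : Ideal R) {d} → Member I d → Member (principal d) ⊆ Member I
  principal-⊆ I {d} d∈I (x , r≈dx) =
    Ideal.resp I (trans (*-comm x d) (sym r≈dx)) (Ideal.*-closed I x d∈I)

  idealSetoid : Ideal R → Setoid (c ⊔ ℓ) ℓ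
  idealSetoid I = record
    { Carrier       = ∃ (Member I)
    ; _≈_           = λ (x , _) (y , _) → x ≈ y
    ; isEquivalence = record { refl = refl ; sym = sym ; trans = trans }
    }

  record PrincipalIdealAbove (a b : Carrier) : Set (lsuc (c ⊔ ℓ)) where
    field
      ideal       : Ideal R
      isPrincipal : ∃[ d ] Member ideal ≐ Member (principal d)
      above-a     : Member (principal a) ⊆ Member ideal
      above-b     : Member (principal b) ⊆ Member ideal

  open PrincipalIdealAbove public using (ideal)

  principalIdealAboveSetoid : Carrier → Carrier → Setoid (lsuc (c ⊔ ℓ)) (c ⊔ ℓ)
  principalIdealAboveSetoid a b = record
    { Carrier       = PrincipalIdealAbove a b
    ; _≈_           = λ D E → Member (ideal D) ≐ Member (ideal E)
    ; isEquivalence = record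
      { refl  = (λ p → p) , (λ p → p)
      ; sym   = λ (f , g) → g , f
      ; trans = λ (f , g) (f′ , g′) → (λ p → f′ (f p)) , (λ p → g (g′ p))
      }
    }

  module _ (fin : Finite setoid) where
    open Finite fin

    principal? : ∀ d → Unary.Decidable (Member (principal d))
    principal? d r = ∃? (λ x≈y p → trans p (*-congˡ x≈y)) (λ x → r ≟ d * x)

    ^⊥? : ∀ d → Unary.Decidable (Member (d ^⊥))
    ^⊥? d r = map′
      (λ rd≈0 x (y , x≈dy) → begin
        r * x         ≈⟨ *-congˡ x≈dy ⟩
        r * (d * y)   ≈⟨ *-assoc r d y ⟨
        r * d * y     ≈⟨ *-congʳ rd≈0 ⟩
        0# * y        ≈⟨ zeroˡ y ⟩
        0#            ∎)
      (λ p → p d (d∈principal d))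
      (r * d ≟ 0#)

    ^⊥-finite : ∀ d → Finite (idealSetoid (d ^⊥))
    ^⊥-finite d = finite-cover (idealSetoid (d ^⊥))
      (λ (x , _) (y , _) → x ≟ y) (member ∘ element)
      (λ (x , x∈) → position x , member-≈ x∈ (element-position x))
      where
      member : Carrier → ∃ (Member (d ^⊥))
      member r with ^⊥? d r
      ... | yes p = r , p
      ... | no _  = 0# , Ideal.0-closed (d ^⊥)

      member-≈ : ∀ {x r} → Member (d ^⊥) x → r ≈ x → proj₁ (member r) ≈ x
      member-≈ {x} {r} x∈ r≈x with ^⊥? d r
      ... | yes _ = r≈x
      ... | no ¬p = contradiction (Ideal.resp (d ^⊥) (sym r≈x) x∈) ¬p

    /-finite : ∀ d → Finite (CommutativeRing.setoid (R / (d ^⊥)))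
    /-finite d = finite-cover (CommutativeRing.setoid (R / (d ^⊥)))
      (λ x y → ^⊥? d (x - y)) element
      (λ x → position x , ≈⇒∼ (element-position x))
      where
      ≈⇒∼ : ∀ {x y} → x ≈ y → Member (d ^⊥) (x - y)
      ≈⇒∼ {x} {y} x≈y = Ideal.resp (d ^⊥)
        (sym (trans (+-congʳ x≈y) (-‿inverseʳ y))) (Ideal.0-closed (d ^⊥))

    principalIdealAbove-finite : ∀ a b → Finite (principalIdealAboveSetoid a b)
    principalIdealAbove-finite a b = finite-cover S equal? (above ∘ element)
      (λ D → let d , D≐ = PrincipalIdealAbove.isPrincipal D in
        position d , above-≈ D D≐ (element-position d))
      where
      S : Setoid (lsuc (c ⊔ ℓ)) (c ⊔ ℓ)
      S = principalIdealAboveSetoid a b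
      open PrincipalIdealAbove using (isPrincipal; above-a; above-b)

      equal? : Decidable (Setoid._≈_ S)
      equal? D E with isPrincipal D | isPrincipal E
      ... | d , D⊆ , ⊆D | e , E⊆ , ⊆E = map′
        (λ (d∈e , e∈d) →
            (λ p → ⊆E (principal-⊆ (principal e) d∈e (D⊆ p)))
          , (λ p → ⊆D (principal-⊆ (principal d) e∈d (E⊆ p))))
        (λ (D⊆E , E⊆D) →
            E⊆ (D⊆E (⊆D (d∈principal d))) , D⊆ (E⊆D (⊆E (d∈principal e))))
        (principal? e d ×-dec principal? d e)

      above? : ∀ d → Dec (Member (principal d) a × Member (principal d) b)
      above? d = principal? d a ×-dec principal? d b

      generatedBy : ∀ d → Member (principal d) a × Member (principal d) b → PrincipalIdealAbove a b
      generatedBy d (a∈d , b∈d) = record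
        { ideal       = principal d
        ; isPrincipal = d , (λ p → p) , (λ p → p)
        ; above-a     = principal-⊆ (principal d) a∈d
        ; above-b     = principal-⊆ (principal d) b∈d
        }

      above : Carrier → PrincipalIdealAbove a b
      above d with above? d
      ... | yes p = generatedBy d p
      ... | no _  = generatedBy 1# ((a , sym (*-identityˡ a)) , (b , sym (*-identityˡ b)))

      above-≈ : ∀ D {d e} → Member (ideal D) ≐ Member (principal d) → e ≈ d →
                Setoid._≈_ S (above e) D
      above-≈ D {d} {e} (D⊆ , ⊆D) e≈d with above? e
      ... | yes _ = (λ (x , p) → ⊆D (x , trans p (*-congʳ e≈d)))
                  , (λ p → let x , q = D⊆ p in x , trans q (*-congʳ (sym e≈d)))
      ... | no ¬p = contradiction
        (e-divides (D⊆ (above-a D (d∈principal a))) , e-divides (D⊆ (above-b D (d∈principal b)))) ¬p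
        where
        e-divides : Member (principal d) ⊆ Member (principal e)
        e-divides (x , p) = x , trans p (*-congʳ (sym e≈d))

additiveGroup : CommutativeRing c ℓ → Group c ℓ
additiveGroup R = CommutativeRing.+-group R

ℂ* : Group 0ℓ 0ℓ
ℂ* = AbelianGroup.group (unitGroup ℂ)

IsHomomorphism : (G : Group a ℓ) (H : Group b ℓ′) → (Group.Carrier G → Group.Carrier H) → Set _
IsHomomorphism G H = GroupMorphisms.IsGroupHomomorphism (Group.rawGroup G) (Group.rawGroup H)

record AdditiveCharacter (R : CommutativeRing c ℓ) : Set (c ⊔ ℓ) where
  open CommutativeRing R
  field
    character      : Carrier → Unit ℂ
    isHomomorphism : IsHomomorphism (additiveGroup R) ℂ* character

  ⟦_⟧ : Carrier → ℂ.Carrier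
  ⟦ r ⟧ = value (character r)

module _ {R : CommutativeRing c ℓ} where
  open CommutativeRing R
  open RingProperties ring
  open AdditiveCharacter
  open SetoidReasoning setoid

  private
    compose : {R′ : CommutativeRing c ℓ′} (ψ : AdditiveCharacter R)
              {f : CommutativeRing.Carrier R′ → Carrier} →
              IsHomomorphism (additiveGroup R′) (additiveGroup R) f → AdditiveCharacter R′
    compose ψ {f} f-hom = record
      { character      = character ψ ∘ f
      ; isHomomorphism = Composition.isGroupHomomorphism
          (λ {u} {v} {w} → Group.trans ℂ* {u} {v} {w}) f-hom (isHomomorphism ψ)
      }

  -- The character c.ψ : r ↦ ψ (c r).
  infixr 9 _∙_
  _∙_ : Carrier → AdditiveCharacter R → AdditiveCharacter R
  d ∙ ψ = compose ψ {d *_} record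
    { isMonoidHomomorphism = record
      { isMagmaHomomorphism = record
        { isRelHomomorphism = record { cong = *-congˡ }
        ; homo = distribˡ d
        }
      ; ε-homo = zeroʳ d
      }
    ; ⁻¹-homo = λ x → sym (-‿distribʳ-* d x)
    }

  -- The character d.ψ, which is trivial on d^⊥, viewed as a character of R/d^⊥.
  infixr 9 _∙⊥_
  _∙⊥_ : (d : Carrier) → AdditiveCharacter R → AdditiveCharacter (R / (_^⊥ R d))
  d ∙⊥ ψ = compose ψ {d *_} record
    { isMonoidHomomorphism = record
      { isMagmaHomomorphism = record
        { isRelHomomorphism = record { cong = λ {x} {y} → well-defined x y }
        ; homo = distribˡ d
        }
      ; ε-homo = zeroʳ d
      }
    ; ⁻¹-homo = λ x → sym (-‿distribʳ-* d x)
    }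
    where
    well-defined : ∀ x y → Member (_^⊥ R d) (x - y) → d * x ≈ d * y
    well-defined x y p = x∙y⁻¹≈ε⇒x≈y (d * x) (d * y) (begin
      d * x - d * y      ≈⟨ +-congˡ (-‿distribʳ-* d y) ⟩
      d * x + d * (- y)  ≈⟨ distribˡ d x (- y) ⟨
      d * (x - y)        ≈⟨ *-comm d (x - y) ⟩
      (x - y) * d        ≈⟨ p d (d∈principal R d) ⟩
      0#                 ∎)

  TrivialOn : AdditiveCharacter R → Ideal R → Set (c ⊔ ℓ)
  TrivialOn ψ I = ∀ x → Member I x → ⟦_⟧ ψ x ℂ.≈ ℂ.1#

  IsConductor : AdditiveCharacter R → Ideal R → Set (lsuc (c ⊔ ℓ))
  IsConductor ψ I = TrivialOn ψ I × (∀ J → TrivialOn ψ J → Member J ⊆ Member I)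

  Primitive : AdditiveCharacter R → Set (lsuc (c ⊔ ℓ))
  Primitive ψ = IsConductor ψ (principal R 0#)

Frobenius : CommutativeRing c ℓ → Set (lsuc (c ⊔ ℓ))
Frobenius R = Σ[ ψ ∈ AdditiveCharacter R ] Primitive ψ

module _ {R : CommutativeRing c ℓ} (fin : Finite (CommutativeRing.setoid R)) where
  open AdditiveCharacter

  Kloosterman : AdditiveCharacter R → AdditiveCharacter R → ℂ.Carrier
  Kloosterman φ ψ = ∑ (unitsFinite R fin) λ u → ⟦_⟧ φ (value u) ℂ.* ⟦_⟧ ψ (inverse u)

module Selberg
  (R : CommutativeRing c ℓ) (fin : Finite (CommutativeRing.setoid R))
  (ψ : AdditiveCharacter R) (a b : CommutativeRing.Carrier R) where

  open CommutativeRing R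
  open AdditiveCharacter ψ using (⟦_⟧)

  -- The choices entering T_D.  R / d^⊥ has the same carrier as R, so lift-mod
  -- states that lift v reduces to v modulo d^⊥.  Note that lift need not
  -- respect the equality of R / d^⊥.
  record Choice (D : PrincipalIdealAbove R a b) : Set (c ⊔ ℓ) where
    field
      d           : Carrier
      d-generates : Member (ideal D) ≐ Member (principal R d)
      a₀ b₀       : Carrier
      a≈da₀       : a ≈ d * a₀
      b≈db₀       : b ≈ d * b₀

    R/d^⊥ : CommutativeRing c (c ⊔ ℓ)
    R/d^⊥ = R / (_^⊥ R d)

    R/d^⊥-finite : Finite (CommutativeRing.setoid R/d^⊥)
    R/d^⊥-finite = /-finite R fin d

    field
      lift      : Unit R/d^⊥ → Unit R
      lift-mod  : ∀ v → CommutativeRing._≈_ R/d^⊥ (value (lift v)) (value v)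

    ∣d^⊥∣ : ℕ
    ∣d^⊥∣ = Finite.size (^⊥-finite R fin d)

    T : ℂ.Carrier
    T = if does (Finite._≟_ fin d 0#) then ℂ.1# else
      ∑ (unitsFinite R/d^⊥ R/d^⊥-finite) λ v →
        ⟦ d * value (lift v) ⟧ ℂ.* ⟦ d * (a₀ * b₀) * inverse (lift v) ⟧

{-# OPTIONS --safe #-}
module Submission where

-- The sum over units y of ψ (a y + b y⁻¹) equals the sum of ψ (x + a y) over all
-- factorisations b = x y: a nonunit y is a zero divisor, and translating x by
-- the annihilator of y multiplies the sum over x by values of ψ that are not
-- all 1, so that this sum vanishes.  For fixed x, on the other hand, the
-- solutions y form a coset of x^⊥, and orthogonality gives
-- |x^⊥| ψ (x + a b₁) with b = x b₁ if x divides a and b, and 0 otherwise.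
-- The generators of D = (d) are the d ṽ for v a unit modulo d^⊥, so those x
-- which generate D contribute |d^⊥| T_D.  This is a sum attached to D alone,
-- hence T_D does not depend on the choices.  Units modulo an ideal lift because
-- some power of every element of a finite ring is idempotent.  Of the complex
-- numbers only this is used: they form a domain of characteristic zero whose
-- equality is stable under double negation.

open import Defs
open import Algebra.Bundles using (AbelianGroup; CommutativeRing)
open import Algebra.Morphism.Structures using (module GroupMorphisms)
import Algebra.Properties.CommutativeSemigroup as CommutativeSemigroupProperties
import Algebra.Properties.Ring as RingProperties
import Algebra.Properties.Semiring.Exp as SemiringExp
import Algebra.Properties.Semiring.Mult as SemiringMult
import Algebra.Properties.Semiring.Sum as SemiringSum
import Algebra.Solver.Ring.NaturalCoefficients.Default as SemiringSolver
open import Data.Bool.Base using (if_then_else_)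
open import Data.Fin.Base as Fin using (Fin; toℕ)
import Data.Fin.Properties as Fin
open import Data.Nat.Base as ℕ using (ℕ; zero; suc)
import Data.Nat.Properties as ℕ
open import Data.Product.Base using (_×_; _,_; proj₁; proj₂; ∃; ∃-syntax; Σ-syntax)
open import Data.Rational.Base as ℚ using (ℚ; 0ℚ; 1ℚ; ½; ∣_∣)
import Data.Rational.Properties as ℚ
open import Data.Rational.Solver using (module +-*-Solver)
open import Data.Sum.Base using (inj₁; inj₂)
open import Data.Unit.Base using (tt)
open import Function.Base using (_∘_)
open import Function.Bundles using (Inverse)
open import Level using (_⊔_) renaming (suc to lsuc)
open import Relation.Binary.Bundles using (Setoid)
open import Relation.Binary.PropositionalEquality as ≡ using (_≡_)
import Relation.Binary.Reasoning.Setoid as SetoidReasoning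
open import Relation.Nullary using (¬_; Dec; yes; no; does)
open import Relation.Nullary.Decidable using (map′; _×-dec_)
open import Relation.Nullary.Negation using (contradiction)
open import Relation.Unary using (_⊆_; _≐_)

-- Null sequences and sequences bounded away from zero.

Apart : (ℕ → ℚ) → Set
Apart x = ∃[ ε ] (0ℚ ℚ.< ε × ∃[ N ] (∀ n → N ℕ.≤ n → ε ℚ.≤ ∣ x n ∣))

halve : ∀ {ε} → 0ℚ ℚ.< ε → ∃[ δ ] (0ℚ ℚ.< δ × δ ℚ.+ δ ≡ ε)
halve {ε} 0<ε = ε ℚ.* ½
  , ≡.subst (ℚ._< ε ℚ.* ½) (ℚ.*-zeroˡ ½) (ℚ.*-monoˡ-<-pos ½ 0<ε)
  , ≡.trans (≡.sym (ℚ.*-distribˡ-+ ε ½ ½)) (ℚ.*-identityʳ ε)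

0<p*q : ∀ {p q} → 0ℚ ℚ.< p → 0ℚ ℚ.< q → 0ℚ ℚ.< p ℚ.* q
0<p*q {p} {q} 0<p 0<q =
  ℚ.positive⁻¹ (p ℚ.* q) {{ℚ.pos*pos⇒pos p {{ℚ.positive 0<p}} q {{ℚ.positive 0<q}}}}

*-mono-≤ : ∀ {p q r s} → 0ℚ ℚ.≤ q → 0ℚ ℚ.≤ r → p ℚ.≤ r → q ℚ.≤ s → p ℚ.* q ℚ.≤ r ℚ.* s
*-mono-≤ {p} {q} {r} {s} 0≤q 0≤r p≤r q≤s = ℚ.≤-trans
  (ℚ.*-monoʳ-≤-nonNeg q {{ℚ.nonNegative 0≤q}} p≤r)
  (ℚ.*-monoˡ-≤-nonNeg r {{ℚ.nonNegative 0≤r}} q≤s)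

∣p∣*∣p∣≡p*p : ∀ p → ∣ p ∣ ℚ.* ∣ p ∣ ≡ p ℚ.* p
∣p∣*∣p∣≡p*p p with ℚ.∣p∣≡p∨∣p∣≡-p p
... | inj₁ eq = ≡.cong₂ ℚ._*_ eq eq
... | inj₂ eq = ≡.trans (≡.cong₂ ℚ._*_ eq eq)
  (solve 1 (λ p → (:- p) :* (:- p) := p :* p) ≡.refl p)
  where open +-*-Solver

0≤p*p : ∀ p → 0ℚ ℚ.≤ p ℚ.* p
0≤p*p p = ≡.subst (0ℚ ℚ.≤_) (∣p∣*∣p∣≡p*p p)
  (≡.subst (ℚ._≤ ∣ p ∣ ℚ.* ∣ p ∣) (ℚ.*-zeroˡ 0ℚ)
    (*-mono-≤ ℚ.≤-refl (ℚ.0≤∣p∣ p) (ℚ.0≤∣p∣ p) (ℚ.0≤∣p∣ p)))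

-- Beyond a suitable `N` the terms differ by less than ε/4, and comparing the single rational
-- `∣ x N ∣` with ε/2 is decidable. If it is smaller, all later terms stay below ε; otherwise they
-- all stay at least ε/4, which is apartness.
¬Apart⇒Null : ∀ {x} → Cauchy x → ¬ Apart x → Null x
¬Apart⇒Null {x} cauchy ¬apart ε 0<ε
  with δ , 0<δ , δ+δ≡ε ← halve 0<ε
  with η , 0<η , η+η≡δ ← halve 0<δ
  with N , close ← cauchy η 0<η
  with ∣ x N ∣ ℚ.<? δ
... | yes xN<δ = N , λ n N≤n → begin-strict
  ∣ x n ∣                   ≡⟨ ≡.cong ∣_∣ (rearrange (x n) (x N)) ⟩
  ∣ (x n ℚ.- x N) ℚ.+ x N ∣ ≤⟨ ℚ.∣p+q∣≤∣p∣+∣q∣ (x n ℚ.- x N) (x N) ⟩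
  ∣ x n ℚ.- x N ∣ ℚ.+ ∣ x N ∣ <⟨ ℚ.+-mono-< (ℚ.<-trans (close n N N≤n ℕ.≤-refl) η<δ) xN<δ ⟩
  δ ℚ.+ δ                   ≡⟨ δ+δ≡ε ⟩
  ε                         ∎
  where
  open ℚ.≤-Reasoning
  rearrange : ∀ p q → p ≡ (p ℚ.- q) ℚ.+ q
  rearrange = solve 2 (λ p q → p := (p :+ :- q) :+ q) ≡.refl
    where open +-*-Solver
  η<δ : η ℚ.< δ
  η<δ = ≡.subst₂ ℚ._<_ (ℚ.+-identityʳ η) η+η≡δ (ℚ.+-monoʳ-< η 0<η)
... | no xN≮δ = contradiction (η , 0<η , N , λ n N≤n → ℚ.≮⇒≥ λ xn<η →
  xN≮δ (begin-strict
    ∣ x N ∣                     ≡⟨ ≡.cong ∣_∣ (rearrange (x N) (x n)) ⟩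
    ∣ (x N ℚ.- x n) ℚ.+ x n ∣   ≤⟨ ℚ.∣p+q∣≤∣p∣+∣q∣ (x N ℚ.- x n) (x n) ⟩
    ∣ x N ℚ.- x n ∣ ℚ.+ ∣ x n ∣ <⟨ ℚ.+-mono-< (close N n ℕ.≤-refl N≤n) xn<η ⟩
    η ℚ.+ η                     ≡⟨ η+η≡δ ⟩
    δ                           ∎)) ¬apart
  where
  open ℚ.≤-Reasoning
  rearrange : ∀ p q → p ≡ (p ℚ.- q) ℚ.+ q
  rearrange = solve 2 (λ p q → p := (p :+ :- q) :+ q) ≡.refl
    where open +-*-Solver

Apart⇒¬Null : ∀ {x} → Apart x → ¬ Null x
Apart⇒¬Null (ε , 0<ε , N , ε≤) null with null ε 0<ε
... | M , <ε = ℚ.<-irrefl ≡.refl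
  (ℚ.<-≤-trans (<ε (N ℕ.⊔ M) (ℕ.m≤n⊔m N M)) (ε≤ (N ℕ.⊔ M) (ℕ.m≤m⊔n N M)))

-- For a Cauchy sequence nullness is the negation of apartness, and negations are stable.
Null-stable : ∀ {x} → Cauchy x → ¬ ¬ Null x → Null x
Null-stable cauchy ¬¬null = ¬Apart⇒Null cauchy λ apart → ¬¬null (Apart⇒¬Null apart)

*-apart : ∀ {x y} → Apart x → Apart y → Apart (λ n → x n ℚ.* y n)
*-apart {x} {y} (ε , 0<ε , M , ε≤) (δ , 0<δ , N , δ≤) =
  ε ℚ.* δ , 0<p*q 0<ε 0<δ , M ℕ.⊔ N , λ n ≤n →
    ≡.subst (ε ℚ.* δ ℚ.≤_) (≡.sym (ℚ.∣p*q∣≡∣p∣*∣q∣ (x n) (y n)))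
      (*-mono-≤ (ℚ.<⇒≤ 0<δ) (ℚ.0≤∣p∣ (x n))
        (ε≤ n (ℕ.m⊔n≤o⇒m≤o M N ≤n)) (δ≤ n (ℕ.m⊔n≤o⇒n≤o M N ≤n)))

-- Adding a square cannot decrease x². Applied to the real and imaginary parts, this shows that a
-- nonzero complex number has nonzero norm.
sumOfSquares-apart : ∀ {x} (y : ℕ → ℚ) → Apart x → Apart (λ n → x n ℚ.* x n ℚ.+ y n ℚ.* y n)
sumOfSquares-apart {x} y (ε , 0<ε , N , ε≤) =
  ε ℚ.* ε , 0<p*q 0<ε 0<ε , N , λ n N≤n → begin
    ε ℚ.* ε                     ≤⟨ *-mono-≤ (ℚ.<⇒≤ 0<ε) (ℚ.0≤∣p∣ (x n)) (ε≤ n N≤n) (ε≤ n N≤n) ⟩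
    ∣ x n ∣ ℚ.* ∣ x n ∣         ≡⟨ ∣p∣*∣p∣≡p*p (x n) ⟩
    x n ℚ.* x n                 ≡⟨ ℚ.+-identityʳ (x n ℚ.* x n) ⟨
    x n ℚ.* x n ℚ.+ 0ℚ          ≤⟨ ℚ.+-monoʳ-≤ (x n ℚ.* x n) (0≤p*p (y n)) ⟩
    x n ℚ.* x n ℚ.+ y n ℚ.* y n ≡⟨ ℚ.0≤p⇒∣p∣≡p (ℚ.+-mono-≤ (0≤p*p (x n)) (0≤p*p (y n))) ⟨
    ∣ x n ℚ.* x n ℚ.+ y n ℚ.* y n ∣ ∎
  where open ℚ.≤-Reasoning

-- If `y` were apart from zero, then `x` could not be, since the product would be apart as well; so
-- `x` would be null.
*-Null-cancelˡ : ∀ {x y} → Cauchy x → Cauchy y →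
                 Null (λ n → x n ℚ.* y n) → ¬ Null x → Null y
*-Null-cancelˡ cx cy null ¬null = ¬Apart⇒Null cy λ y# →
  ¬null (¬Apart⇒Null cx λ x# → Apart⇒¬Null (*-apart x# y#) null)

-- Stability, cancellation and characteristic zero for the complex numbers.

private
  module ℝ = CommutativeRing ℝ

ℝ-null : ∀ x → x ℝ.≈ ℝ.0# → Null (proj₁ x)
ℝ-null x = Ideal.resp nullIdeal {x ℝ.- ℝ.0#} {x} λ n → ℚ.+-identityʳ (proj₁ x n)

null-ℝ : ∀ x → Null (proj₁ x) → x ℝ.≈ ℝ.0#
null-ℝ x = Ideal.resp nullIdeal {x} {x ℝ.- ℝ.0#} λ n → ≡.sym (ℚ.+-identityʳ (proj₁ x n))

ℝ-stable : ∀ x y → ¬ ¬ x ℝ.≈ y → x ℝ.≈ y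
ℝ-stable x y = Null-stable (proj₂ (x ℝ.- y))

ℂ-stable : ∀ z w → ¬ ¬ z ℂ.≈ w → z ℂ.≈ w
ℂ-stable (x , y) (u , v) ¬¬eq =
    ℝ-stable x u (λ ¬p → ¬¬eq λ (p , _) → ¬p p)
  , ℝ-stable y v (λ ¬p → ¬¬eq λ (_ , p) → ¬p p)

-- Multiplying z * w ≈ 0 by the conjugate of z = x + y i leaves the real
-- multiple x² + y² of w.
ℂ-cancel : ∀ z w → z ℂ.* w ℂ.≈ ℂ.0# → ¬ z ℂ.≈ ℂ.0# → w ℂ.≈ ℂ.0#
ℂ-cancel (x , y) (u , v) (re≈0 , im≈0) z≉0 =
    null-ℝ u (cancel u (combine ∣z∣²u x re y im ∣z∣²u≡ re-null im-null))
  , null-ℝ v (cancel v (combine ∣z∣²v x im (ℝ.- y) re ∣z∣²v≡ im-null re-null))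
  where
  re im ∣z∣² ∣z∣²u ∣z∣²v : ℝ.Carrier
  re = x ℝ.* u ℝ.- y ℝ.* v
  im = x ℝ.* v ℝ.+ y ℝ.* u
  ∣z∣² = x ℝ.* x ℝ.+ y ℝ.* y
  ∣z∣²u = ∣z∣² ℝ.* u
  ∣z∣²v = ∣z∣² ℝ.* v

  re-null : Null (proj₁ re)
  re-null = ℝ-null re re≈0
  im-null : Null (proj₁ im)
  im-null = ℝ-null im im≈0

  combine : ∀ s p q r t →
            (∀ n → proj₁ p n ℚ.* proj₁ q n ℚ.+ proj₁ r n ℚ.* proj₁ t n ≡ proj₁ s n) →
            Null (proj₁ q) → Null (proj₁ t) → Null (proj₁ s)
  combine s p q r t eq q-null t-null =
    Ideal.resp nullIdeal {p ℝ.* q ℝ.+ r ℝ.* t} {s} eq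
      (Ideal.+-closed nullIdeal {p ℝ.* q} {r ℝ.* t}
        (Ideal.*-closed nullIdeal p {q} q-null) (Ideal.*-closed nullIdeal r {t} t-null))

  ∣z∣²u≡ : ∀ n → _ ≡ proj₁ ∣z∣²u n
  ∣z∣²u≡ n = solve 4 (λ x y u v →
    x :* (x :* u :+ :- (y :* v)) :+ y :* (x :* v :+ y :* u) := (x :* x :+ y :* y) :* u)
    ≡.refl (proj₁ x n) (proj₁ y n) (proj₁ u n) (proj₁ v n)
    where open +-*-Solver

  ∣z∣²v≡ : ∀ n → _ ≡ proj₁ ∣z∣²v n
  ∣z∣²v≡ n = solve 4 (λ x y u v →
    x :* (x :* v :+ y :* u) :+ (:- y) :* (x :* u :+ :- (y :* v)) := (x :* x :+ y :* y) :* v)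
    ≡.refl (proj₁ x n) (proj₁ y n) (proj₁ u n) (proj₁ v n)
    where open +-*-Solver

  ¬null : ¬ Null (proj₁ ∣z∣²)
  ¬null null = z≉0
    ( null-ℝ x (¬Apart⇒Null (proj₂ x) λ x# →
        Apart⇒¬Null (sumOfSquares-apart (proj₁ y) x#) null)
    , null-ℝ y (¬Apart⇒Null (proj₂ y) λ y# →
        Apart⇒¬Null (sumOfSquares-apart (proj₁ x) y#)
          (Ideal.resp nullIdeal {∣z∣²} {y ℝ.* y ℝ.+ x ℝ.* x}
            (λ n → ℚ.+-comm (proj₁ x n ℚ.* proj₁ x n) (proj₁ y n ℚ.* proj₁ y n)) null)) )

  cancel : ∀ w → Null (proj₁ (∣z∣² ℝ.* w)) → Null (proj₁ w)
  cancel w null = *-Null-cancelˡ (proj₂ ∣z∣²) (proj₂ w) null ¬null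

-- Every term of the real part is at least 1, so the real part is apart from zero.
ℂ-characteristic-0 : ∀ n → ¬ suc n · ℂ.1# ℂ.≈ ℂ.0#
ℂ-characteristic-0 n (re≈0 , _) = Apart⇒¬Null
  (1ℚ , ℚ.positive⁻¹ 1ℚ , 0 , λ k _ → ℚ.≤-trans (1≤re k)
    (ℚ.≤-reflexive (≡.sym (ℚ.0≤p⇒∣p∣≡p (0≤re (suc n) k)))))
  (ℝ-null (proj₁ (suc n · ℂ.1#)) re≈0)
  where
  re : ℕ → ℕ → ℚ
  re n = proj₁ (proj₁ (n · ℂ.1#))
  0≤re : ∀ n k → 0ℚ ℚ.≤ re n k
  0≤re zero    k = ℚ.≤-refl
  0≤re (suc n) k = ℚ.+-mono-≤ (ℚ.nonNegative⁻¹ 1ℚ) (0≤re n k)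
  1≤re : ∀ k → 1ℚ ℚ.≤ re (suc n) k
  1≤re k = ℚ.+-monoʳ-≤ 1ℚ (0≤re n k)

-- Cardinalities and sums over finite sets.

size-mono : ∀ {s σ t τ} {S : Setoid s σ} {T : Setoid t τ} (F : Finite S) (G : Finite T) →
            let module S = Setoid S; module T = Setoid T in
            (h : S.Carrier → T.Carrier) → (∀ {x y} → h x T.≈ h y → x S.≈ y) →
            Finite.size F ℕ.≤ Finite.size G
size-mono {S = S} {T} F G h h-injective = Fin.injective⇒≤ λ {i} {j} eq →
  element-injective (h-injective
    (T.trans (T.sym (G.element-position _)) (T.trans (T.reflexive (≡.cong G.element eq))
      (G.element-position _))))
  where
  module S = Setoid S
  module T = Setoid T
  module F = Finite F
  module G = Finite G
  element-injective : ∀ {i j} → F.element i S.≈ F.element j → i ≡ j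
  element-injective eq = ≡.trans (≡.sym (Inverse.inverseʳ F.enumeration S.refl))
    (Inverse.inverseʳ F.enumeration eq)

size-nonZero : ∀ {s σ} {S : Setoid s σ} (F : Finite S) → Setoid.Carrier S →
               ∃[ n ] Finite.size F ≡ ℕ.suc n
size-nonZero F x with Finite.size F | Finite.position F x
... | ℕ.suc n | _ = n , ≡.refl

module FiniteSum {k κ} (K : CommutativeRing k κ) where
  open CommutativeRing K
  open SemiringSum semiring
  open SemiringMult semiring using () renaming (_×_ to _·ᴷ_)
  open SetoidReasoning setoid

  sumOver : ∀ {s σ} {S : Setoid s σ} → Finite S → (Setoid.Carrier S → Carrier) → Carrier
  sumOver F f = sum (f ∘ Finite.element F)

  -- A sum over a decidable subset is written as a sum over the whole set with this indicator, so
  -- that such sums can be interchanged without enumerating the subset.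
  when : ∀ {p} {P : Set p} → Dec P → Carrier → Carrier
  when d x = if does d then x else 0#

  when-yes : ∀ {p} {P : Set p} (d : Dec P) {x} → P → when d x ≈ x
  when-yes (yes _) _ = refl
  when-yes (no ¬p) p = contradiction p ¬p

  when-no : ∀ {p} {P : Set p} (d : Dec P) {x} → ¬ P → when d x ≈ 0#
  when-no (yes p) ¬p = contradiction p ¬p
  when-no (no _)  _  = refl

  when-zero : ∀ {p} {P : Set p} (d : Dec P) {x} → x ≈ 0# → when d x ≈ 0#
  when-zero (yes _) x≈0 = x≈0
  when-zero (no _)  _   = refl

  when-cong : ∀ {p q} {P : Set p} {Q : Set q} (d : Dec P) (e : Dec Q) →
              (P → Q) → (Q → P) → ∀ {x y} → (P → x ≈ y) → when d x ≈ when e y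
  when-cong (yes p) (yes _) _   _   x≈y = x≈y p
  when-cong (yes p) (no ¬q) p⇒q _   _   = contradiction (p⇒q p) ¬q
  when-cong (no ¬p) (yes q) _   q⇒p _   = contradiction (q⇒p q) ¬p
  when-cong (no _)  (no _)  _   _   _   = refl

  *-when : ∀ {p} {P : Set p} (d : Dec P) x y → x * when d y ≈ when d (x * y)
  *-when (yes _) x y = refl
  *-when (no _)  x y = zeroʳ x

  module _ {s σ} {S : Setoid s σ} (F : Finite S) where
    private
      module S = Setoid S
      module F = Finite F

    sumOver-cong : ∀ {f g} → (∀ x → f x ≈ g x) → sumOver F f ≈ sumOver F g
    sumOver-cong f≈g = sum-cong-≋ (f≈g ∘ F.element)

    sumOver-zero : ∀ {f} → (∀ x → f x ≈ 0#) → sumOver F f ≈ 0#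
    sumOver-zero f≈0 = trans (sumOver-cong f≈0) (sum-replicate-zero F.size)

    sumOver-one : sumOver F (λ _ → 1#) ≈ F.size ·ᴷ 1#
    sumOver-one = sum-replicate F.size

    *-sumOver : ∀ x f → x * sumOver F f ≈ sumOver F (λ y → x * f y)
    *-sumOver x f = *-distribˡ-sum x (f ∘ F.element)

    -- The enumeration is without repetition, so exactly one index contributes. The hypotheses range
    -- over all `x` equal to `x₀` because the enumeration contains only some representative of `x₀`.
    sumOver-unique : ∀ {p} {P : S.Carrier → Set p} (P? : ∀ x → Dec (P x)) {f : S.Carrier → Carrier} {v} x₀ →
                     (∀ x → x S.≈ x₀ → P x) → (∀ x → P x → x S.≈ x₀) →
                     (∀ x → x S.≈ x₀ → f x ≈ v) →
                     sumOver F (λ x → when (P? x) (f x)) ≈ v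
    sumOver-unique P? {f} {v} x₀ ≈⇒P P⇒≈ f≈v = sum-single (F.position x₀)
      (trans (when-yes (P? _) (≈⇒P _ ≈x₀)) (f≈v _ ≈x₀))
      (λ j j≢ → when-no (P? _) λ p → j≢ (≡.sym (Inverse.inverseʳ F.enumeration (S.sym (P⇒≈ _ p)))))
      where
      ≈x₀ : F.element (F.position x₀) S.≈ x₀
      ≈x₀ = F.element-position x₀

      sum-single : ∀ {n} {t : Fin n → Carrier} i → t i ≈ v → (∀ j → ¬ j ≡ i → t j ≈ 0#) → sum t ≈ v
      sum-single {ℕ.suc n} Fin.zero t≈v t≈0 = trans
        (+-cong t≈v (trans (sum-cong-≋ (λ j → t≈0 (Fin.suc j) λ ())) (sum-replicate-zero n)))
        (+-identityʳ v)
      sum-single (Fin.suc i) t≈v t≈0 = trans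
        (+-cong (t≈0 Fin.zero λ ())
                (sum-single i t≈v λ j j≢ → t≈0 (Fin.suc j) (j≢ ∘ Fin.suc-injective)))
        (+-identityˡ v)

  sumOver-comm : ∀ {s σ t τ} {S : Setoid s σ} {T : Setoid t τ} (F : Finite S) (G : Finite T)
                 (f : Setoid.Carrier S → Setoid.Carrier T → Carrier) →
                 sumOver F (λ x → sumOver G (f x)) ≈ sumOver G (λ y → sumOver F (λ x → f x y))
  sumOver-comm F G f = ∑-comm {Finite.size F} {Finite.size G} λ i j → f (Finite.element F i) (Finite.element G j)

  module _ {s σ t τ} {S : Setoid s σ} {T : Setoid t τ} (F : Finite S) (G : Finite T) where
    private
      module S = Setoid S
      module T = Setoid T

    -- Double counting of the graph of `h`: over each `x` with `P x` lies exactly one `y`, over the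
    -- other `x` none, and each `y` lies over exactly one `x`.
    sumOver-reindex : ∀ {p} {P : S.Carrier → Set p} (P? : ∀ x → Dec (P x)) {f : S.Carrier → Carrier} →
                      (∀ {x y} → x S.≈ y → f x ≈ f y) → (h : T.Carrier → S.Carrier) →
                      (∀ {x y} → x T.≈ y → h x S.≈ h y) → (∀ {x y} → h x S.≈ h y → x T.≈ y) →
                      (∀ y x → h y S.≈ x → P x) → (∀ x → P x → ∃[ y ] h y S.≈ x) →
                      sumOver F (λ x → when (P? x) (f x)) ≈ sumOver G (f ∘ h)
    sumOver-reindex P? {f} f-cong h h-cong h-injective h∈P P⊆h = begin
      sumOver F (λ x → when (P? x) (f x))
        ≈⟨ sumOver-cong F fibre ⟩
      sumOver F (λ x → sumOver G (λ y → when (h y ≟ x) (f x)))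
        ≈⟨ sumOver-comm F G (λ x y → when (h y ≟ x) (f x)) ⟩
      sumOver G (λ y → sumOver F (λ x → when (h y ≟ x) (f x)))
        ≈⟨ sumOver-cong G (λ y → sumOver-unique F (h y ≟_) (h y)
             (λ _ → S.sym) (λ _ → S.sym) (λ _ → f-cong)) ⟩
      sumOver G (f ∘ h) ∎
      where
      open Finite F using (_≟_)
      fibre : ∀ x → when (P? x) (f x) ≈ sumOver G (λ y → when (h y ≟ x) (f x))
      fibre x with P? x
      ... | no ¬p = sym (sumOver-zero G λ y → when-no (h y ≟ x) λ eq → ¬p (h∈P y x eq))
      ... | yes p with y₀ , hy₀≈x ← P⊆h x p = sym (sumOver-unique G (λ y → h y ≟ x) y₀
        (λ y y≈y₀ → S.trans (h-cong y≈y₀) hy₀≈x)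
        (λ y hy≈x → h-injective (S.trans hy≈x (S.sym hy₀≈x)))
        (λ _ _ → refl))

-- Congruence modulo an ideal and modulo an annihilator.

module _ {c ℓ} (R : CommutativeRing c ℓ) where
  open CommutativeRing R
  open RingProperties ring
    renaming (x∙y⁻¹≈ε⇒x≈y to x-y≈0⇒x≈y; x≈y⇒x∙y⁻¹≈ε to x≈y⇒x-y≈0)

  ≈⇒∼ : (I : Ideal R) → ∀ {x y} → x ≈ y → Member I (x - y)
  ≈⇒∼ I {x} {y} x≈y =
    Ideal.resp I (sym (trans (+-congʳ x≈y) (-‿inverseʳ y))) (Ideal.0-closed I)

  ∈⇒∼0 : (I : Ideal R) → ∀ {x} → Member I x → Member I (x - 0#)
  ∈⇒∼0 I {x} = Ideal.resp I (sym (trans (+-congˡ -0#≈0#) (+-identityʳ x)))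

  ∼0⇒∈ : (I : Ideal R) → ∀ {x} → Member I (x - 0#) → Member I x
  ∼0⇒∈ I {x} = Ideal.resp I (trans (+-congˡ -0#≈0#) (+-identityʳ x))

  -- Together with its converse `*≈*⇒∼`, this identifies R/d^⊥ with the ideal (d) through
  -- multiplication by `d`.
  ∼⇒*≈* : ∀ d {x y} → Member (_^⊥ R d) (x - y) → d * x ≈ d * y
  ∼⇒*≈* d {x} {y} p = x-y≈0⇒x≈y (d * x) (d * y)
    (trans (sym (x[y-z]≈xy-xz d x y)) (trans (*-comm d (x - y)) (p d (d∈principal R d))))

  *≈*⇒∼ : ∀ d {x y} → d * x ≈ d * y → Member (_^⊥ R d) (x - y)
  *≈*⇒∼ d {x} {y} dx≈dy z (t , z≈dt) = begin
    (x - y) * z        ≈⟨ *-congˡ z≈dt ⟩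
    (x - y) * (d * t)  ≈⟨ *-assoc (x - y) d t ⟨
    (x - y) * d * t    ≈⟨ *-congʳ (*-comm (x - y) d) ⟩
    d * (x - y) * t    ≈⟨ *-congʳ (x[y-z]≈xy-xz d x y) ⟩
    (d * x - d * y) * t ≈⟨ *-congʳ (x≈y⇒x-y≈0 dx≈dy) ⟩
    0# * t             ≈⟨ zeroˡ t ⟩
    0#                 ∎
    where open SetoidReasoning setoid

-- Idempotent powers and lifting of units in a finite ring.

module _ {c ℓ} (R : CommutativeRing c ℓ) (fin : Finite (CommutativeRing.setoid R)) where
  open CommutativeRing R
  open Finite fin
  open SemiringExp semiring
  open SemiringSolver commutativeSemiring
  open RingProperties ring using (-0#≈0#)

  -- Two powers x^i ≈ x^(i+p) agree by the pigeonhole principle; the exponent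
  -- (i + 1) p is then a multiple of the period that is at least i.
  idempotent-power : ∀ x → ∃[ n ] x ^ suc n * x ^ suc n ≈ x ^ suc n
  idempotent-power x
    with i , j , i<j , eq ← Fin.pigeonhole (ℕ.n<1+n size) (λ i → position (x ^ toℕ i))
    with k , i+k≡j ← ℕ.m≤n⇒∃[o]m+o≡n i<j
    -- The inequality i < j reads `suc i ≤ j`, so the period j - i is `suc k`, which is positive.
    -- The successor of the witness is `m`, that is (i + 1) times the period.
    = k ℕ.+ i′ ℕ.* suc k , sym (begin
      x ^ m                     ≈⟨ ^-congʳ x i+r≡m ⟨
      x ^ (i′ ℕ.+ r)            ≈⟨ ^-homo-* x i′ r ⟩
      x ^ i′ * x ^ r            ≈⟨ *-congʳ (periodic (suc i′)) ⟩
      x ^ i′ * x ^ m * x ^ r    ≈⟨ solve 3 (λ a b c → a :* b :* c := a :* c :* b) refl _ _ _ ⟩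
      x ^ i′ * x ^ r * x ^ m    ≈⟨ *-congʳ (^-homo-* x i′ r) ⟨
      x ^ (i′ ℕ.+ r) * x ^ m    ≈⟨ *-congʳ (^-congʳ x i+r≡m) ⟩
      x ^ m * x ^ m             ∎)
    where
    open SetoidReasoning setoid
    i′ m r : ℕ
    i′ = toℕ i
    m = suc i′ ℕ.* suc k
    i′≤m : i′ ℕ.≤ m
    i′≤m = ℕ.≤-trans (ℕ.n≤1+n i′) (ℕ.m≤m*n (suc i′) (suc k))
    r = m ℕ.∸ i′
    i+r≡m : i′ ℕ.+ r ≡ m
    i+r≡m = ℕ.m+[n∸m]≡n i′≤m

    x^i≈x^j : x ^ i′ ≈ x ^ toℕ j
    x^i≈x^j = trans (sym (element-position _))
      (trans (reflexive (≡.cong element eq)) (element-position _))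

    period : x ^ i′ ≈ x ^ i′ * x ^ suc k
    period = begin
      x ^ i′               ≈⟨ x^i≈x^j ⟩
      x ^ toℕ j            ≈⟨ ^-congʳ x (≡.trans (ℕ.+-suc i′ k) i+k≡j) ⟨
      x ^ (i′ ℕ.+ suc k)   ≈⟨ ^-homo-* x i′ (suc k) ⟩
      x ^ i′ * x ^ suc k   ∎

    periodic : ∀ c → x ^ i′ ≈ x ^ i′ * x ^ (c ℕ.* suc k)
    periodic zero    = sym (*-identityʳ _)
    periodic (suc c) = begin
      x ^ i′                                     ≈⟨ period ⟩
      x ^ i′ * x ^ suc k                         ≈⟨ *-congʳ (periodic c) ⟩
      x ^ i′ * x ^ (c ℕ.* suc k) * x ^ suc k     ≈⟨ solve 3 (λ a b c → a :* b :* c := a :* (c :* b)) refl _ _ _ ⟩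
      x ^ i′ * (x ^ suc k * x ^ (c ℕ.* suc k))   ≈⟨ *-congˡ (^-homo-* x (suc k) (c ℕ.* suc k)) ⟨
      x ^ i′ * x ^ (suc c ℕ.* suc k)             ∎

  -- Let e be the idempotent v^(n+1) and f = 1 - e.  Then v e + f is a unit,
  -- because v is one in the factor e R, and it is congruent to v because
  -- v^(n+1) annihilates f.
  module _ (I : Ideal R) (v : Carrier) (cancel : ∀ {x} → Member I (v * x) → Member I x)
           (n : ℕ) (ee≈e : v ^ suc n * v ^ suc n ≈ v ^ suc n) where
    private
      t e f : Carrier
      t = v ^ n
      e = v * t
      f = 1# - e

      e+f≈1 : e + f ≈ 1#
      e+f≈1 = begin
        e + (1# - e)   ≈⟨ +-comm e f ⟩
        1# - e + e     ≈⟨ +-assoc 1# (- e) e ⟩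
        1# + (- e + e) ≈⟨ +-congˡ (-‿inverseˡ e) ⟩
        1# + 0#        ≈⟨ +-identityʳ 1# ⟩
        1#             ∎
        where open SetoidReasoning setoid

      ef≈0 : e * f ≈ 0#
      ef≈0 = +-cancel (begin
        e + e * f       ≈⟨ +-congʳ ee≈e ⟨
        e * e + e * f   ≈⟨ distribˡ e e f ⟨
        e * (e + f)     ≈⟨ *-congˡ e+f≈1 ⟩
        e * 1#          ≈⟨ *-identityʳ e ⟩
        e               ≈⟨ +-identityʳ e ⟨
        e + 0#          ∎)
        where
        open SetoidReasoning setoid
        +-cancel : ∀ {x y} → e + x ≈ e + y → x ≈ y
        +-cancel {x} {y} = RingProperties.+-cancelˡ ring e x y

      ff≈f : f * f ≈ f
      ff≈f = begin
        f * f           ≈⟨ +-identityˡ _ ⟨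
        0# + f * f      ≈⟨ +-congʳ ef≈0 ⟨
        e * f + f * f   ≈⟨ distribʳ f e f ⟨
        (e + f) * f     ≈⟨ *-congʳ e+f≈1 ⟩
        1# * f          ≈⟨ *-identityˡ f ⟩
        f               ∎
        where open SetoidReasoning setoid

      -- As `v * t` is `e`, the identity of the factor e R, `t * e` inverts `v * e` there; the mixed
      -- terms contain e f and vanish.
      isUnit : (v * e + f) * (t * e + f) ≈ 1#
      isUnit = begin
        (v * e + f) * (t * e + f)
          ≈⟨ solve 4 (λ v t e f → (v :* e :+ f) :* (t :* e :+ f) :=
               (v :* t) :* (e :* e) :+ ((v :+ t) :* (e :* f) :+ f :* f)) refl v t e f ⟩
        e * (e * e) + ((v + t) * (e * f) + f * f)
          ≈⟨ +-cong (trans (*-congˡ ee≈e) ee≈e) (+-cong (trans (*-congˡ ef≈0) (zeroʳ _)) ff≈f) ⟩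
        e + (0# + f)
          ≈⟨ +-congˡ (+-identityˡ f) ⟩
        e + f
          ≈⟨ e+f≈1 ⟩
        1# ∎
        where open SetoidReasoning setoid

      cancel-^ : ∀ m {x} → Member I (v ^ m * x) → Member I x
      cancel-^ zero    = Ideal.resp I (*-identityˡ _)
      cancel-^ (suc m) p = cancel-^ m (cancel (Ideal.resp I (*-assoc v (v ^ m) _) p))

      f∈I : Member I f
      f∈I = cancel-^ (suc n) (Ideal.resp I (sym ef≈0) (Ideal.0-closed I))

      congruent : Member I (v * e + f - v)
      congruent = begin
        v * e + f        ≈⟨ Q.+-congˡ {v * e} {f} {0#} (∈⇒∼0 R I f∈I) ⟩
        v * e + 0#       ≈⟨ Q.+-congˡ {v * e} {0#} {v * f} (Q.sym {v * f} {0#} (∈⇒∼0 R I (Ideal.*-closed I v f∈I))) ⟩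
        v * e + v * f    ≈⟨ ≈⇒∼ R I (trans (sym (distribˡ v e f)) (trans (*-congˡ e+f≈1) (*-identityʳ v))) ⟩
        v                ∎
        where
        module Q = CommutativeRing (R / I)
        open SetoidReasoning Q.setoid

    idempotentPower⇒unit : ∃[ u ] Member I (value {R = R} u - v)
    idempotentPower⇒unit = unit (v * e + f) (t * e + f) isUnit , congruent

  abstract
    -- Stated for elements cancellable modulo `I`, so that it covers both the units of R/I and, with
    -- `I` the zero ideal, the non-zero-divisors of R.
    cancellable⇒unit : (I : Ideal R) (v : Carrier) →
                       (∀ {x} → Member I (v * x) → Member I x) →
                       ∃[ u ] Member I (value {R = R} u - v)
    cancellable⇒unit I v cancel =
      let n , ee≈e = idempotent-power v in idempotentPower⇒unit I v cancel n ee≈e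

  unit-lift : (I : Ideal R) (v : Unit (R / I)) → ∃[ u ] Member I (value {R = R} u - value v)
  unit-lift I v = cancellable⇒unit I (value v) λ {x} vx∈I → ∼0⇒∈ R I (begin
    x                             ≈⟨ Q.*-identityˡ x ⟨
    1# * x                        ≈⟨ Q.*-congʳ {x} {value v * inverse v} {1#} (Unit.isInverse v) ⟨
    value v * inverse v * x       ≈⟨ ≈⇒∼ R I (solve 3 (λ v w x → v :* w :* x := w :* (v :* x)) refl _ _ _) ⟩
    inverse v * (value v * x)     ≈⟨ ∈⇒∼0 R I (Ideal.*-closed I (inverse v) vx∈I) ⟩
    0#                            ∎)
    where
    module Q = CommutativeRing (R / I)
    open SetoidReasoning Q.setoid

  nonZeroDivisor⇒invertible : ∀ y → (∀ x → y * x ≈ 0# → x ≈ 0#) → ∃[ z ] y * z ≈ 1#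
  nonZeroDivisor⇒invertible y cancel
    with u , z , u-y≈0*z ← cancellable⇒unit (principal R 0#) y
           (λ (z , yx≈0*z) → 0# , trans (cancel _ (trans yx≈0*z (zeroˡ z))) (sym (zeroˡ 0#)))
    = inverse u , trans (*-congʳ (sym u≈y)) (Unit.isInverse u)
    where
    u≈y : value u ≈ y
    u≈y = RingProperties.x∙y⁻¹≈ε⇒x≈y ring _ _ (trans u-y≈0*z (zeroˡ z))

-- Character sums with values in an abstract domain.

record IsStableDomain₀ {k κ} (K : CommutativeRing k κ) : Set (k ⊔ κ) where
  open CommutativeRing K
  open SemiringMult semiring using () renaming (_×_ to _·ᴷ_)
  field
    stable           : ∀ x y → ¬ ¬ x ≈ y → x ≈ y
    cancel           : ∀ x y → x * y ≈ 0# → ¬ x ≈ 0# → y ≈ 0#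
    characteristic-0 : ∀ n → ¬ suc n ·ᴷ 1# ≈ 0#

ℂ-isStableDomain₀ : IsStableDomain₀ ℂ
ℂ-isStableDomain₀ = record
  { stable           = ℂ-stable
  ; cancel           = ℂ-cancel
  ; characteristic-0 = ℂ-characteristic-0
  }

-- `primitive-χ` is the conductor condition for the principal ideals (z), in terms of elements.
record IsPrimitiveCharacter {c ℓ k κ} (R : CommutativeRing c ℓ) (K : CommutativeRing k κ)
                            (χ : CommutativeRing.Carrier R → CommutativeRing.Carrier K) :
                            Set (c ⊔ ℓ ⊔ k ⊔ κ) where
  open CommutativeRing K
  private module R = CommutativeRing R
  field
    χ-cong      : ∀ {x y} → x R.≈ y → χ x ≈ χ y
    χ-+         : ∀ x y → χ (x R.+ y) ≈ χ x * χ y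
    χ-0         : χ R.0# ≈ 1#
    primitive-χ : ∀ z → (∀ x → χ (z R.* x) ≈ 1#) → z R.≈ R.0#

module CharacterSum
  {c ℓ k κ} (R : CommutativeRing c ℓ) (fin : Finite (CommutativeRing.setoid R))
  (K : CommutativeRing k κ) (isStableDomain₀ : IsStableDomain₀ K)
  (χ : CommutativeRing.Carrier R → CommutativeRing.Carrier K)
  (isPrimitiveCharacter : IsPrimitiveCharacter R K χ) where

  open CommutativeRing K
  open IsStableDomain₀ isStableDomain₀
  open IsPrimitiveCharacter isPrimitiveCharacter
  open SemiringMult semiring renaming (_×_ to _·ᴷ_)
  open FiniteSum K
  open SetoidReasoning setoid
  open RingProperties ring using (x[y-z]≈xy-xz; x∙y⁻¹≈ε⇒x≈y; x≈y⇒x∙y⁻¹≈ε)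
  open CommutativeSemigroupProperties *-commutativeSemigroup using (x∙yz≈y∙xz)
  open Finite fin
  private
    module R = CommutativeRing R
    module RSolver = SemiringSolver R.commutativeSemiring
    module RProp = RingProperties R.ring

  ∑ᴿ : (R.Carrier → Carrier) → Carrier
  ∑ᴿ = sumOver fin

  *-cancel : ∀ {x y z} → ¬ x ≈ 0# → x * y ≈ x * z → y ≈ z
  *-cancel {x} {y} {z} x≉0 eq = x∙y⁻¹≈ε⇒x≈y y z
    (cancel x (y - z) (trans (x[y-z]≈xy-xz x y z) (x≈y⇒x∙y⁻¹≈ε eq)) x≉0)

  -- Serves to cancel the factor |d^⊥|, which is positive, when two values of T_D are compared.
  ·-cancel : ∀ {m n} → m ≡ n → ∃[ k ] m ≡ suc k → ∀ x y → m ·ᴷ x ≈ n ·ᴷ y → x ≈ y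
  ·-cancel ≡.refl (k , ≡.refl) x y eq = *-cancel (characteristic-0 k)
    (trans (·1* x) (trans eq (sym (·1* y))))
    where
    ·1* : ∀ z → suc k ·ᴷ 1# * z ≈ suc k ·ᴷ z
    ·1* z = trans (×-assoc-* (suc k) 1# z) (×-congʳ (suc k) (*-identityˡ z))

  ∑ᴿ-translate : ∀ {f} → (∀ {x y} → x R.≈ y → f x ≈ f y) → ∀ g → ∑ᴿ f ≈ ∑ᴿ (λ x → f (x R.+ g))
  ∑ᴿ-translate f-cong g = sumOver-reindex fin fin (λ _ → yes tt) f-cong (R._+ g)
    R.+-congʳ (RProp.+-cancelʳ g _ _) (λ _ _ _ → tt)
    (λ x _ → x R.- g , RProp.//-rightDividesˡ g x)

  -- Translation by `g` permutes R and so preserves the sum, but it also multiplies it by `α`; a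
  -- nonzero sum can be cancelled.
  eigenvalue≈1 : ∀ {f} → (∀ {x y} → x R.≈ y → f x ≈ f y) → ∀ g α →
                 (∀ x → f (x R.+ g) ≈ α * f x) → ¬ ∑ᴿ f ≈ 0# → α ≈ 1#
  eigenvalue≈1 {f} f-cong g α f-+g ∑≉0 = *-cancel ∑≉0 (begin
    ∑ᴿ f * α                  ≈⟨ *-comm (∑ᴿ f) α ⟩
    α * ∑ᴿ f                  ≈⟨ *-sumOver fin α f ⟩
    ∑ᴿ (λ x → α * f x)        ≈⟨ sumOver-cong fin f-+g ⟨
    ∑ᴿ (λ x → f (x R.+ g))    ≈⟨ ∑ᴿ-translate f-cong g ⟨
    ∑ᴿ f                      ≈⟨ *-identityʳ (∑ᴿ f) ⟨
    ∑ᴿ f * 1#                 ∎)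

  -- If the sum were nonzero, all eigenvalues χ (z g) would be 1, against primitivity. Stability of
  -- equality turns this refutation into a proof.
  orthogonality : ∀ z → ¬ z R.≈ R.0# → ∑ᴿ (λ x → χ (z R.* x)) ≈ 0#
  orthogonality z z≉0 = stable _ _ λ ∑≉0 → z≉0 (primitive-χ z λ g →
    eigenvalue≈1 (χ-cong ∘ R.*-congˡ) g (χ (z R.* g))
      (λ x → trans (χ-cong (R.distribˡ z x g)) (trans (χ-+ _ _) (*-comm _ _))) ∑≉0)

  invertible? : ∀ y → Dec (∃[ z ] y R.* z R.≈ R.1#)
  invertible? y = ∃? (λ z≈w p → R.trans (R.*-congˡ (R.sym z≈w)) p) (λ z → y R.* z ≟ R.1#)

  -- If `y` kills `g`, translation by any multiple g r preserves x y = b and multiplies the summand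
  -- by χ (g r). A nonzero sum would force all these values to be 1, hence g = 0; then `y` would be
  -- a non-zero-divisor, thus a unit.
  nonunit-vanishing : ∀ b y → ¬ (∃[ z ] y R.* z R.≈ R.1#) →
                      ∑ᴿ (λ x → when (x R.* y ≟ b) (χ x)) ≈ 0#
  nonunit-vanishing b y ¬unit = stable _ _ λ ∑≉0 →
    ¬unit (nonZeroDivisor⇒invertible R fin y λ g yg≈0 → primitive-χ g λ r →
      eigenvalue≈1
        (λ x≈z → when-cong (_ ≟ b) (_ ≟ b) (R.trans (R.*-congʳ (R.sym x≈z)))
          (R.trans (R.*-congʳ x≈z)) (λ _ → χ-cong x≈z))
        (g R.* r) (χ (g R.* r))
        (λ x → let x+gr*y≈x*y = shift x g r yg≈0 in trans
          (when-cong (_ ≟ b) (_ ≟ b) (R.trans (R.sym x+gr*y≈x*y)) (R.trans x+gr*y≈x*y)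
            (λ _ → trans (χ-+ x (g R.* r)) (*-comm _ _)))
          (sym (*-when (_ ≟ b) _ _)))
        ∑≉0)
    where
    shift : ∀ x g r → y R.* g R.≈ R.0# → (x R.+ g R.* r) R.* y R.≈ x R.* y
    shift x g r yg≈0 = R.trans
      (solve 4 (λ x g r y → (x :+ g :* r) :* y := x :* y :+ r :* (y :* g)) R.refl x g r y)
      (R.trans (R.+-congˡ (R.trans (R.*-congˡ yg≈0) (R.zeroʳ r))) (R.+-identityʳ _))
      where open RSolver

  ∣_^⊥∣ : R.Carrier → Carrier
  ∣ x ^⊥∣ = ∑ᴿ λ k → when (x R.* k ≟ R.0#) 1#

  ∣^⊥∣-size : ∀ x → ∣ x ^⊥∣ ≈ Finite.size (^⊥-finite R fin x) ·ᴷ 1#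
  ∣^⊥∣-size x = trans
    (sumOver-reindex fin (^⊥-finite R fin x) (λ k → x R.* k ≟ R.0#) (λ _ → refl) proj₁
      (λ eq → eq) (λ eq → eq)
      (λ (y , y∈x^⊥) k y≈k → R.trans (R.*-comm x k)
        (R.trans (R.*-congʳ (R.sym y≈k)) (y∈x^⊥ x (d∈principal R x))))
      (λ k xk≈0 → (k , λ z (t , z≈xt) → R.trans (R.*-congˡ z≈xt) (annihilates k t xk≈0)) , R.refl))
    (sumOver-one (^⊥-finite R fin x))
    where
    annihilates : ∀ k t → x R.* k R.≈ R.0# → k R.* (x R.* t) R.≈ R.0#
    annihilates k t xk≈0 = R.trans
      (RSolver.solve 3 (λ k x t → k RSolver.:* (x RSolver.:* t) RSolver.:= (x RSolver.:* k) RSolver.:* t) R.refl k x t)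
      (R.trans (R.*-congʳ xk≈0) (R.zeroˡ t))

  -- In effect the double annihilator property of (x). By orthogonality |R| times the indicator of x
  -- k = 0 is the sum over t of χ (x k t). Summing over `k` first leaves the characters of a + x t,
  -- none of which is zero, and |R| is nonzero in K.
  sumOver-^⊥-χ : ∀ x a → ¬ Member (principal R x) a →
                 ∑ᴿ (λ k → when (x R.* k ≟ R.0#) (χ (a R.* k))) ≈ 0#
  sumOver-^⊥-χ x a a∉x with m , size≡ ← size-nonZero fin R.0# = cancel (suc m ·ᴷ 1#) _ (begin
      suc m ·ᴷ 1# * ∑ᴿ (λ k → when (x R.* k ≟ R.0#) (χ (a R.* k)))
        ≈⟨ *-sumOver fin (suc m ·ᴷ 1#) (λ k → when (x R.* k ≟ R.0#) (χ (a R.* k))) ⟩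
      ∑ᴿ (λ k → suc m ·ᴷ 1# * when (x R.* k ≟ R.0#) (χ (a R.* k)))
        ≈⟨ sumOver-cong fin expand ⟩
      ∑ᴿ (λ k → ∑ᴿ λ t → χ ((a R.+ x R.* t) R.* k))
        ≈⟨ sumOver-comm fin fin (λ k t → χ ((a R.+ x R.* t) R.* k)) ⟩
      ∑ᴿ (λ t → ∑ᴿ λ k → χ ((a R.+ x R.* t) R.* k))
        ≈⟨ sumOver-zero fin (λ t → orthogonality (a R.+ x R.* t) (a∉x ∘ multiple t)) ⟩
      0# ∎)
    (characteristic-0 m)
    where
    multiple : ∀ t → a R.+ x R.* t R.≈ R.0# → Member (principal R x) a
    multiple t eq = R.- t , R.trans (RProp.+-inverseˡ-unique a (x R.* t) eq) (RProp.-‿distribʳ-* x t)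

    expand : ∀ k → suc m ·ᴷ 1# * when (x R.* k ≟ R.0#) (χ (a R.* k))
                 ≈ ∑ᴿ (λ t → χ ((a R.+ x R.* t) R.* k))
    expand k = begin
      suc m ·ᴷ 1# * when (x R.* k ≟ R.0#) (χ (a R.* k))
        ≈⟨ total (x R.* k ≟ R.0#) ⟩
      χ (a R.* k) * ∑ᴿ (λ t → χ ((x R.* k) R.* t))
        ≈⟨ *-sumOver fin (χ (a R.* k)) (λ t → χ ((x R.* k) R.* t)) ⟩
      ∑ᴿ (λ t → χ (a R.* k) * χ ((x R.* k) R.* t))
        ≈⟨ sumOver-cong fin (λ t → trans (sym (χ-+ _ _)) (χ-cong
             (RSolver.solve 4 (λ a k x t → a RSolver.:* k RSolver.:+ (x RSolver.:* k) RSolver.:* t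
               RSolver.:= (a RSolver.:+ x RSolver.:* t) RSolver.:* k) R.refl a k x t))) ⟩
      ∑ᴿ (λ t → χ ((a R.+ x R.* t) R.* k)) ∎
      where
      total : (d : Dec (x R.* k R.≈ R.0#)) →
              suc m ·ᴷ 1# * when d (χ (a R.* k)) ≈ χ (a R.* k) * ∑ᴿ (λ t → χ ((x R.* k) R.* t))
      total (no xk≉0) = trans (zeroʳ _)
        (sym (trans (*-congˡ (orthogonality (x R.* k) xk≉0)) (zeroʳ _)))
      total (yes xk≈0) = trans (*-comm _ _) (*-congˡ (sym (begin
        ∑ᴿ (λ t → χ ((x R.* k) R.* t)) ≈⟨ sumOver-cong fin (λ t →
          trans (χ-cong (R.trans (R.*-congʳ xk≈0) (R.zeroˡ t))) χ-0) ⟩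
        ∑ᴿ (λ _ → 1#)                  ≈⟨ sumOver-one fin ⟩
        size ·ᴷ 1#                     ≡⟨ ≡.cong (_·ᴷ 1#) size≡ ⟩
        suc m ·ᴷ 1#                    ∎)))

  -- The Kloosterman sum as a sum over factorisations of b.

  module _ (a b : R.Carrier) where

    -- A factorisation b = x y contributes χ (x + a y); the units y give
    -- exactly the Kloosterman sum.
    N : R.Carrier → Carrier
    N x = ∑ᴿ λ y → when (x R.* y ≟ b) (χ (x R.+ a R.* y))

    N-cong : ∀ {x z} → x R.≈ z → N x ≈ N z
    N-cong {x} {z} x≈z = sumOver-cong fin λ y → when-cong (x R.* y ≟ b) (z R.* y ≟ b)
      (R.trans (R.*-congʳ (R.sym x≈z))) (R.trans (R.*-congʳ x≈z)) (λ _ → χ-cong (R.+-congʳ {a R.* y} x≈z))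

    -- For a unit `u` the only factorisation b = x u has x = b u⁻¹. Completing the sum from units to
    -- all `y` adds only vanishing terms.
    kloosterman≈∑N : sumOver (unitsFinite R fin) (λ u → χ (a R.* value u R.+ b R.* inverse u)) ≈ ∑ᴿ N
    kloosterman≈∑N = begin
      sumOver U (λ u → χ (a R.* value u R.+ b R.* inverse u))
        ≈⟨ sumOver-cong U (λ u → sumOver-unique fin (λ x → x R.* value u ≟ b) (b R.* inverse u)
             (λ x x≈ → R.trans (R.*-congʳ x≈) (solve-x u))
             (λ x xu≈b → x≈ u x xu≈b)
             (λ x x≈ → χ-cong (R.trans (R.+-congʳ x≈) (R.+-comm (b R.* inverse u) (a R.* value u))))) ⟨
      sumOver U (λ u → M (value u))
        ≈⟨ sumOver-reindex fin U invertible? M-cong value (λ eq → eq) (λ eq → eq)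
             (λ u y u≈y → inverse u , R.trans (R.*-congʳ (R.sym u≈y)) (Unit.isInverse u))
             (λ y (z , yz≈1) → unit y z yz≈1 , R.refl) ⟨
      ∑ᴿ (λ y → when (invertible? y) (M y))
        ≈⟨ sumOver-cong fin (λ y → onlyUnits y (invertible? y)) ⟩
      ∑ᴿ M
        ≈⟨ sumOver-comm fin fin (λ y x → when (x R.* y ≟ b) (χ (x R.+ a R.* y))) ⟩
      ∑ᴿ N ∎
      where
      U : Finite (unitSetoid R)
      U = unitsFinite R fin

      M : R.Carrier → Carrier
      M y = ∑ᴿ λ x → when (x R.* y ≟ b) (χ (x R.+ a R.* y))

      M-cong : ∀ {y z} → y R.≈ z → M y ≈ M z
      M-cong {y} {z} y≈z = sumOver-cong fin λ x → when-cong (x R.* y ≟ b) (x R.* z ≟ b)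
        (R.trans (R.*-congˡ (R.sym y≈z))) (R.trans (R.*-congˡ y≈z))
        (λ _ → χ-cong (R.+-congˡ {x} (R.*-congˡ {a} y≈z)))

      solve-x : ∀ u → (b R.* inverse u) R.* value u R.≈ b
      solve-x u = R.trans (R.*-assoc _ _ _) (R.trans (R.*-congˡ
        (R.trans (R.*-comm _ _) (Unit.isInverse u))) (R.*-identityʳ b))

      x≈ : ∀ u x → x R.* value u R.≈ b → x R.≈ b R.* inverse u
      x≈ u x xu≈b = R.trans (R.sym (R.*-identityʳ x)) (R.trans
        (R.*-congˡ (R.sym (Unit.isInverse u))) (R.trans (R.sym (R.*-assoc _ _ _)) (R.*-congʳ xu≈b)))

      onlyUnits : ∀ y (d : Dec (∃[ z ] y R.* z R.≈ R.1#)) → when d (M y) ≈ M y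
      onlyUnits y (yes _) = refl
      onlyUnits y (no ¬unit) = sym (begin
        M y
          ≈⟨ sumOver-cong fin (λ x → trans
               (when-cong (x R.* y ≟ b) (x R.* y ≟ b) (λ p → p) (λ p → p)
                 (λ _ → trans (χ-+ x (a R.* y)) (*-comm _ _)))
               (sym (*-when (x R.* y ≟ b) (χ (a R.* y)) (χ x)))) ⟩
        ∑ᴿ (λ x → χ (a R.* y) * when (x R.* y ≟ b) (χ x))
          ≈⟨ *-sumOver fin (χ (a R.* y)) (λ x → when (x R.* y ≟ b) (χ x)) ⟨
        χ (a R.* y) * ∑ᴿ (λ x → when (x R.* y ≟ b) (χ x))
          ≈⟨ *-congˡ (nonunit-vanishing b y ¬unit) ⟩
        χ (a R.* y) * 0#
          ≈⟨ zeroʳ _ ⟩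
        0# ∎)

    -- The solutions of x y = b are the k + b₁ with `k` in x^⊥.
    N-factor : ∀ x b₁ → b R.≈ x R.* b₁ →
               N x ≈ χ (x R.+ a R.* b₁) * ∑ᴿ (λ k → when (x R.* k ≟ R.0#) (χ (a R.* k)))
    N-factor x b₁ b≈xb₁ = begin
      N x
        ≈⟨ ∑ᴿ-translate (λ y≈z → when-cong (_ ≟ b) (_ ≟ b)
             (R.trans (R.*-congˡ (R.sym y≈z))) (R.trans (R.*-congˡ y≈z))
             (λ _ → χ-cong (R.+-congˡ (R.*-congˡ y≈z)))) b₁ ⟩
      ∑ᴿ (λ k → when (x R.* (k R.+ b₁) ≟ b) (χ (x R.+ a R.* (k R.+ b₁))))
        ≈⟨ sumOver-cong fin (λ k → trans
             (when-cong (_ ≟ b) (_ ≟ R.0#) (to k) (from k) (λ _ → trans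
               (χ-cong (RSolver.solve 4 (λ x a k b → x RSolver.:+ a RSolver.:* (k RSolver.:+ b)
                 RSolver.:= (x RSolver.:+ a RSolver.:* b) RSolver.:+ a RSolver.:* k) R.refl x a k b₁))
               (χ-+ _ _)))
             (sym (*-when (_ ≟ R.0#) _ _))) ⟩
      ∑ᴿ (λ k → χ (x R.+ a R.* b₁) * when (x R.* k ≟ R.0#) (χ (a R.* k)))
        ≈⟨ *-sumOver fin (χ (x R.+ a R.* b₁)) (λ k → when (x R.* k ≟ R.0#) (χ (a R.* k))) ⟨
      χ (x R.+ a R.* b₁) * ∑ᴿ (λ k → when (x R.* k ≟ R.0#) (χ (a R.* k))) ∎
      where
      to : ∀ k → x R.* (k R.+ b₁) R.≈ b → x R.* k R.≈ R.0#
      to k eq = RProp.+-cancelʳ (x R.* b₁) _ _ (R.trans (R.sym (R.distribˡ x k b₁))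
        (R.trans eq (R.trans b≈xb₁ (R.sym (R.+-identityˡ _)))))
      from : ∀ k → x R.* k R.≈ R.0# → x R.* (k R.+ b₁) R.≈ b
      from k eq = R.trans (R.distribˡ x k b₁) (R.trans (R.+-congʳ eq)
        (R.trans (R.+-identityˡ _) (R.sym b≈xb₁)))

    -- When `x` divides `a`, the character k ↦ χ (a k) is trivial on x^⊥, so the second factor of
    -- `N-factor` counts x^⊥.
    N-divisor : ∀ x a₁ b₁ → a R.≈ x R.* a₁ → b R.≈ x R.* b₁ →
                N x ≈ χ (x R.+ a R.* b₁) * ∣ x ^⊥∣
    N-divisor x a₁ b₁ a≈xa₁ b≈xb₁ = trans (N-factor x b₁ b≈xb₁) (*-congˡ
      (sumOver-cong fin λ k → when-cong (_ ≟ R.0#) (_ ≟ R.0#) (λ p → p) (λ p → p) λ xk≈0 →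
        trans (χ-cong (R.trans (R.*-congʳ a≈xa₁) (R.trans
          (RSolver.solve 3 (λ x a k → (x RSolver.:* a) RSolver.:* k RSolver.:=
             a RSolver.:* (x RSolver.:* k)) R.refl x a₁ k)
          (R.trans (R.*-congˡ xk≈0) (R.zeroʳ a₁))))) χ-0))

    -- If `x` does not divide `b` there is no factorisation; if it divides `b` but not `a`, the sum
    -- over x^⊥ vanishes.
    N-nondivisor : ∀ x → ¬ (Member (principal R x) a × Member (principal R x) b) → N x ≈ 0#
    N-nondivisor x ¬divides with principal? R fin x b
    ... | no b∉x = sumOver-zero fin λ y → when-no (x R.* y ≟ b) {χ (x R.+ a R.* y)} λ xy≈b → b∉x (y , R.sym xy≈b)
    ... | yes b∈x@(b₁ , b≈xb₁) = trans (N-factor x b₁ b≈xb₁)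
      (trans (*-congˡ (sumOver-^⊥-χ x a λ a∈x → ¬divides (a∈x , b∈x))) (zeroʳ _))

    -- Grouping by principal ideals.

    𝒟 : Finite (principalIdealAboveSetoid R a b)
    𝒟 = principalIdealAbove-finite R fin a b

    -- Membership in an abstract ideal carries no decision, but comparison with the given generator
    -- of `D` reduces the question to two divisibilities.
    generates? : (D : PrincipalIdealAbove R a b) (x : R.Carrier) →
                 Dec (Member (ideal D) ≐ Member (principal R x))
    generates? D x with d , D⊆d , d⊆D ← PrincipalIdealAbove.isPrincipal D = map′
      (λ (d∈x , x∈d) → (λ p → principal-⊆ R (principal R x) d∈x (D⊆d p))
                     , (λ p → d⊆D (principal-⊆ R (principal R d) x∈d p)))
      (λ (D⊆x , x⊆D) → D⊆x (d⊆D (d∈principal R d)) , D⊆d (x⊆D (d∈principal R x)))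
      (principal? R fin x d ×-dec principal? R fin d x)

    -- A common divisor `x` of `a` and `b` generates exactly one ideal of `𝒟`, namely (x); for every
    -- other `x` the value `N x` is zero.
    ∑N≈∑∑N : ∑ᴿ N ≈ sumOver 𝒟 (λ D → ∑ᴿ λ x → when (generates? D x) (N x))
    ∑N≈∑∑N = trans
      (sumOver-cong fin λ x → fibre x (principal? R fin x a ×-dec principal? R fin x b))
      (sumOver-comm fin 𝒟 λ x D → when (generates? D x) (N x))
      where
      fibre : ∀ x → Dec (Member (principal R x) a × Member (principal R x) b) →
              N x ≈ sumOver 𝒟 (λ D → when (generates? D x) (N x))
      fibre x (no ¬divides) = trans (N-nondivisor x ¬divides) (sym (sumOver-zero 𝒟 λ D →
        when-zero (generates? D x) (N-nondivisor x ¬divides)))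
      fibre x (yes (a∈x , b∈x)) = sym (sumOver-unique 𝒟 (λ D → generates? D x) {f = λ _ → N x}
        (record
          { ideal       = principal R x
          ; isPrincipal = x , (λ p → p) , (λ p → p)
          ; above-a     = principal-⊆ R (principal R x) a∈x
          ; above-b     = principal-⊆ R (principal R x) b∈x
          })
        (λ _ eq → eq) (λ _ eq → eq) (λ _ _ → refl))

    ∑-generators : PrincipalIdealAbove R a b → Carrier
    ∑-generators D = ∑ᴿ λ x → when (generates? D x) (N x)

    ∑-generators-cong : ∀ D E → Member (ideal D) ≐ Member (ideal E) →
                        ∑-generators D ≈ ∑-generators E
    ∑-generators-cong D E (D⊆E , E⊆D) = sumOver-cong fin λ x →
      when-cong (generates? D x) (generates? E x)
        (λ (D⊆x , x⊆D) → (λ p → D⊆x (E⊆D p)) , (λ p → D⊆E (x⊆D p)))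
        (λ (E⊆x , x⊆E) → (λ p → E⊆x (D⊆E p)) , (λ p → E⊆D (x⊆E p)))
        (λ _ → refl {N x})

    kloosterman≈∑∑-generators : ∀ t → (∀ D → ∑-generators D ≈ t D) →
      sumOver (unitsFinite R fin) (λ u → χ (a R.* value u R.+ b R.* inverse u)) ≈ sumOver 𝒟 t
    kloosterman≈∑∑-generators t ∑≈t =
      trans kloosterman≈∑N (trans ∑N≈∑∑N (sumOver-cong 𝒟 {∑-generators} {t} ∑≈t))

    -- The contribution of a single ideal.

    module Generator
      (D : PrincipalIdealAbove R a b)
      (d : R.Carrier) (D≐d : Member (ideal D) ≐ Member (principal R d))
      (a₀ b₀ : R.Carrier) (a≈da₀ : a R.≈ d R.* a₀) (b≈db₀ : b R.≈ d R.* b₀)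
      (lift : Unit (R / (_^⊥ R d)) → Unit R)
      (lift-mod : ∀ v → CommutativeRing._≈_ (R / (_^⊥ R d)) (value (lift v)) (value v))
      (V : Finite (unitSetoid (R / (_^⊥ R d))))
      where

      private
        I : Ideal R
        I = _^⊥ R d

        generator : Unit (R / I) → R.Carrier
        generator v = d R.* value (lift v)

        d*lift : ∀ v → generator v R.≈ d R.* value v
        d*lift v = ∼⇒*≈* R d (lift-mod v)

      term : Unit (R / I) → Carrier
      term v = χ (d R.* value (lift v)) * χ (d R.* (a₀ R.* b₀) R.* inverse (lift v))

      -- With u = ṽ and x = d u, one has a = x (u⁻¹ a₀) and b = x (u⁻¹ b₀), so that x + a b₁ = d u +
      -- d a₀ b₀ u⁻¹. Moreover x^⊥ = d^⊥, since `u` is a unit.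
      N-generator : ∀ v → N (generator v) ≈ term v * ∣ d ^⊥∣
      N-generator v = trans
        (N-divisor (generator v) (u⁻¹ R.* a₀) (u⁻¹ R.* b₀) (quotient a≈da₀) (quotient b≈db₀))
        (*-cong (trans (χ-cong (R.+-congˡ ab₁)) (χ-+ _ _))
          (sumOver-cong fin λ k → when-cong (_ ≟ R.0#) (_ ≟ R.0#) (to k) (from k) (λ _ → refl)))
        where
        u u⁻¹ : R.Carrier
        u = value (lift v)
        u⁻¹ = inverse (lift v)
        open RSolver
        quotient : ∀ {y z} → y R.≈ d R.* z → y R.≈ generator v R.* (u⁻¹ R.* z)
        quotient {y} {z} y≈dz = R.sym (R.trans
          (solve 4 (λ d u w z → (d :* u) :* (w :* z) := (d :* z) :* (u :* w)) R.refl d u u⁻¹ z)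
          (R.trans (R.*-congˡ (Unit.isInverse (lift v)))
            (R.trans (R.*-identityʳ _) (R.sym y≈dz))))
        ab₁ : a R.* (u⁻¹ R.* b₀) R.≈ d R.* (a₀ R.* b₀) R.* u⁻¹
        ab₁ = R.trans (R.*-congʳ a≈da₀)
          (solve 4 (λ d a w b → (d :* a) :* (w :* b) := (d :* (a :* b)) :* w) R.refl d a₀ u⁻¹ b₀)
        from : ∀ k → d R.* k R.≈ R.0# → generator v R.* k R.≈ R.0#
        from k eq = R.trans (solve 3 (λ d u k → (d :* u) :* k := u :* (d :* k)) R.refl d u k)
          (R.trans (R.*-congˡ eq) (R.zeroʳ u))
        to : ∀ k → generator v R.* k R.≈ R.0# → d R.* k R.≈ R.0#
        to k eq = R.trans (R.sym (R.*-identityʳ _)) (R.trans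
          (R.*-congˡ (R.sym (Unit.isInverse (lift v)))) (R.trans
          (solve 4 (λ d k u w → (d :* k) :* (u :* w) := w :* ((d :* u) :* k)) R.refl d k u u⁻¹)
          (R.trans (R.*-congˡ eq) (R.zeroʳ u⁻¹))))

      -- v ↦ d ṽ is a bijection from the units modulo d^⊥ to the generators of D.
      ∑-generators≈∑-units : ∑-generators D ≈ sumOver V (λ v → N (generator v))
      ∑-generators≈∑-units = sumOver-reindex fin V (generates? D) N-cong generator
        (λ {v} {w} v∼w → R.trans (d*lift v) (R.trans (∼⇒*≈* R d v∼w) (R.sym (d*lift w))))
        (λ {v} {w} eq → *≈*⇒∼ R d (R.trans (R.sym (d*lift v)) (R.trans eq (d*lift w))))
        (λ v x dv≈x → let u = lift v in
            (λ p → principal-⊆ R (principal R x) {d} (inverse u , d≈ u dv≈x) (proj₁ D≐d p))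
          , (λ p → proj₂ D≐d (principal-⊆ R (principal R d) {x} (value u , R.sym dv≈x) p)))
        -- From x = d y and d = x z follows d y z = d, so `z` inverts `y` modulo d^⊥.
        (λ x (D⊆x , x⊆D) →
          let y , x≈dy = proj₁ D≐d (x⊆D (d∈principal R x))
              z , d≈xz = D⊆x (proj₂ D≐d (d∈principal R d))
              v = unit y z (*≈*⇒∼ R d (R.trans (R.sym (R.*-assoc d y z))
                    (R.trans (R.*-congʳ (R.sym x≈dy)) (R.trans (R.sym d≈xz) (R.sym (R.*-identityʳ d))))))
          in v , R.trans (d*lift v) (R.sym x≈dy))
        where
        d≈ : ∀ u {x} → d R.* value u R.≈ x → d R.≈ x R.* inverse u
        d≈ u du≈x = R.trans (R.sym (R.*-identityʳ d)) (R.trans (R.*-congˡ (R.sym (Unit.isInverse u)))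
          (R.trans (R.sym (R.*-assoc _ _ _)) (R.*-congʳ du≈x)))

      ∑-generators≈∣d^⊥∣T : ∑-generators D ≈
                            Finite.size (^⊥-finite R fin d) ·ᴷ sumOver V term
      ∑-generators≈∣d^⊥∣T = begin
        ∑-generators D
          ≈⟨ ∑-generators≈∑-units ⟩
        sumOver V (λ v → N (generator v))
          ≈⟨ sumOver-cong V (λ v → trans (N-generator v) (*-comm _ _)) ⟩
        sumOver V (λ v → ∣ d ^⊥∣ * term v)
          ≈⟨ *-sumOver V ∣ d ^⊥∣ term ⟨
        ∣ d ^⊥∣ * sumOver V term
          ≈⟨ *-congʳ (∣^⊥∣-size d) ⟩
        n ·ᴷ 1# * sumOver V term
          ≈⟨ ×-assoc-* n 1# _ ⟩
        n ·ᴷ (1# * sumOver V term)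
          ≈⟨ ×-congʳ n (*-identityˡ _) ⟩
        n ·ᴷ sumOver V term ∎
        where
        n : ℕ
        n = Finite.size (^⊥-finite R fin d)

      -- For d = 0 the quotient R/d^⊥ is the zero ring: its only unit class contributes χ 0 χ 0 = 1,
      -- in accordance with the value prescribed for T_D.
      sumOver-term-zero : d R.≈ R.0# → sumOver V term ≈ 1#
      sumOver-term-zero d≈0 = sumOver-unique V (λ _ → yes tt) {f = term} (AbelianGroup.ε (unitGroup (R / I)))
        (λ _ _ → tt)
        (λ v _ → *≈*⇒∼ R d (R.trans (d*≈0 _) (R.sym (d*≈0 R.1#))))
        (λ v _ → trans (*-cong (trans (χ-cong (d*≈0 _)) χ-0)
            (trans (χ-cong (R.trans (R.*-assoc d _ _) (d*≈0 _))) χ-0))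
          (*-identityˡ 1#))
        where
        d*≈0 : ∀ y → d R.* y R.≈ R.0#
        d*≈0 y = R.trans (R.*-congʳ d≈0) (R.zeroˡ y)

-- Sizes of annihilators and primitivity of quotient characters.

module _ {c ℓ} (R : CommutativeRing c ℓ) (fin : Finite (CommutativeRing.setoid R)) where
  open CommutativeRing R

  annihilator-antitone : ∀ {I J : Ideal R} → Member I ⊆ Member J →
                         Member (annihilator R J) ⊆ Member (annihilator R I)
  annihilator-antitone I⊆J p x x∈I = p x (I⊆J x∈I)

  ^⊥-size-mono : ∀ d e → Member (principal R e) ⊆ Member (principal R d) →
                 Finite.size (^⊥-finite R fin d) ℕ.≤ Finite.size (^⊥-finite R fin e)
  ^⊥-size-mono d e e⊆d = size-mono (^⊥-finite R fin d) (^⊥-finite R fin e)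
    (λ (x , x∈d^⊥) → x , annihilator-antitone {principal R e} {principal R d} e⊆d x∈d^⊥)
    (λ eq → eq)

module _ {c ℓ} {R : CommutativeRing c ℓ} (ψ : AdditiveCharacter R) where
  open CommutativeRing R
  open AdditiveCharacter ψ
  open GroupMorphisms.IsGroupHomomorphism isHomomorphism using (⟦⟧-cong; homo; ε-homo)

  ⟦⟧-primitive : Primitive ψ → ∀ z → (∀ x → ⟦ z * x ⟧ ℂ.≈ ℂ.1#) → z ≈ 0#
  ⟦⟧-primitive (_ , largest) z trivial =
    let t , z≈0t = largest (principal R z)
          (λ x (t , x≈zt) → ℂ.trans {⟦ x ⟧} {⟦ z * t ⟧} {ℂ.1#} (⟦⟧-cong x≈zt) (trivial t))
          (d∈principal R z)
    in trans z≈0t (zeroˡ t)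

  -- If d.ψ is trivial on an ideal containing `r`, then `ψ` is trivial on all multiples of d r.
  -- Hence d r = 0, which means that `r` is zero in R/d^⊥.
  ∙⊥-primitive : Primitive ψ → ∀ d → Primitive (d ∙⊥ ψ)
  ∙⊥-primitive prim d = trivialOn , largest
    where
    trivialOn : TrivialOn (d ∙⊥ ψ) (principal (R / (_^⊥ R d)) 0#)
    trivialOn x (t , x∼0t) = ℂ.trans {⟦ d * x ⟧} {⟦ 0# ⟧} {ℂ.1#}
      (⟦⟧-cong (trans (∼⇒*≈* R d x∼0t) (trans (*-congˡ (zeroˡ t)) (zeroʳ d)))) ε-homo

    largest : ∀ J → TrivialOn (d ∙⊥ ψ) J → Member J ⊆ Member (principal (R / (_^⊥ R d)) 0#)
    largest J trivial {r} r∈J = 0# , *≈*⇒∼ R d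
      (trans dr≈0 (sym (trans (*-congˡ (zeroˡ 0#)) (zeroʳ d))))
      where
      dr≈0 : d * r ≈ 0#
      dr≈0 = ⟦⟧-primitive prim (d * r) λ x →
        ℂ.trans {⟦ d * r * x ⟧} {⟦ d * (x * r) ⟧} {ℂ.1#}
          (⟦⟧-cong (trans (*-assoc d r x) (*-congˡ (*-comm r x))))
          (trivial (x * r) (Ideal.*-closed J x r∈J))

-- If IsKloosterman were transparent, unification against the implicitly inferred
-- ring R/d^⊥ would unfold the sums down to Cauchy sequences.  For the same reason
-- SummandsOf leaves R′ a variable, tied to R only by an equation.
opaque
  IsKloosterman : ℂ.Carrier → ∀ {c ℓ} {R : CommutativeRing c ℓ} (fin : Finite (CommutativeRing.setoid R))
                  (φ ψ : AdditiveCharacter R) → Set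
  IsKloosterman x {R = R} fin φ ψ = x ℂ.≈ Kloosterman {R = R} fin φ ψ

module _ {c ℓ} (R : CommutativeRing c ℓ) (fin : Finite (CommutativeRing.setoid R))
         (f : Unit R → ℂ.Carrier) where
  open AdditiveCharacter using (⟦_⟧)

  SummandsOf : {R′ : CommutativeRing c ℓ} (fin′ : Finite (CommutativeRing.setoid R′))
               (φ ψ : AdditiveCharacter R′) → Set (lsuc (c ⊔ ℓ))
  SummandsOf {R′} fin′ φ ψ =
    Σ[ eq ∈ _≡_ {A = ∃ λ (S : CommutativeRing c ℓ) → Finite (CommutativeRing.setoid S)}
              (R , fin) (R′ , fin′) ]
      (∀ u → f (≡.subst (Unit ∘ proj₁) (≡.sym eq) u) ℂ.≈ ⟦_⟧ φ (value u) ℂ.* ⟦_⟧ ψ (inverse u))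

  opaque
    unfolding IsKloosterman

    SummandsOf⇒IsKloosterman : ∀ x → x ℂ.≈ ∑ (unitsFinite R fin) f →
                               ∀ {R′} fin′ φ ψ → SummandsOf {R′} fin′ φ ψ →
                               IsKloosterman x {R = R′} fin′ φ ψ
    SummandsOf⇒IsKloosterman x x≈∑f fin φ ψ (≡.refl , f≈) =
      ℂ.trans {x} {∑ (unitsFinite R fin) f} {Kloosterman {R = R} fin φ ψ} x≈∑f
        (FiniteSum.sumOver-cong ℂ (unitsFinite R fin)
          {f} {λ u → ⟦_⟧ φ (value u) ℂ.* ⟦_⟧ ψ (inverse u)} f≈)

-- Choices, independence of the choices, and the identity over the complex numbers.

module _ {c ℓ} (R : CommutativeRing c ℓ) (fin : Finite (CommutativeRing.setoid R))
         (_ : Frobenius R) (ψ : AdditiveCharacter R) (prim : Primitive ψ)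
         (a b : CommutativeRing.Carrier R) where

  open CommutativeRing R
  open AdditiveCharacter ψ using (⟦_⟧; isHomomorphism)
  open GroupMorphisms.IsGroupHomomorphism isHomomorphism using (⟦⟧-cong; homo; ε-homo)
  open Selberg R fin ψ a b
  open Choice

  private
    isPrimitiveCharacter : IsPrimitiveCharacter R ℂ ⟦_⟧
    isPrimitiveCharacter = record
      { χ-cong      = ⟦⟧-cong
      ; χ-+         = homo
      ; χ-0         = ε-homo
      ; primitive-χ = ⟦⟧-primitive ψ prim
      }

    open CharacterSum R fin ℂ ℂ-isStableDomain₀ ⟦_⟧ isPrimitiveCharacter
    open SemiringMult ℂ.semiring using (×-congʳ)

  choice : (D : PrincipalIdealAbove R a b) → Choice D
  choice D =
    let d , D≐d = PrincipalIdealAbove.isPrincipal D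
        a₀ , a≈da₀ = proj₁ D≐d (PrincipalIdealAbove.above-a D (d∈principal R a))
        b₀ , b≈db₀ = proj₁ D≐d (PrincipalIdealAbove.above-b D (d∈principal R b))
    in record
    { d           = d
    ; d-generates = D≐d
    ; a₀          = a₀
    ; b₀          = b₀
    ; a≈da₀       = a≈da₀
    ; b≈db₀       = b≈db₀
    ; lift        = λ v → proj₁ (unit-lift R fin (_^⊥ R d) v)
    ; lift-mod    = λ v → proj₂ (unit-lift R fin (_^⊥ R d) v)
    }

  module _ (D : PrincipalIdealAbove R a b) (s : Choice D) where
    private
      V : Finite (unitSetoid (R/d^⊥ s))
      V = unitsFinite (R/d^⊥ s) (R/d^⊥-finite s)

      module G = Generator a b D (d s) (d-generates s) (a₀ s) (b₀ s) (a≈da₀ s) (b≈db₀ s)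
                   (lift s) (lift-mod s) V

    quotientTerm : Unit (R/d^⊥ s) → ℂ.Carrier
    quotientTerm = G.term

    T≈∑ : T s ℂ.≈ ∑ V G.term
    -- `T?` restates `T s` so that the decision whether d = 0 can be generalised and split upon;
    -- both branches equal the sum.
    T≈∑ = ≡.subst (ℂ._≈ ∑ V G.term) {T?} {T s} ≡.refl (collapse (Finite._≟_ fin (d s) 0#))
      where
      T? : ℂ.Carrier
      T? = if does (Finite._≟_ fin (d s) 0#) then ℂ.1# else ∑ V G.term
      collapse : (d≟0 : Dec (d s ≈ 0#)) →
                 (if does d≟0 then ℂ.1# else ∑ V G.term) ℂ.≈ ∑ V G.term
      collapse (yes d≈0) = ℂ.sym {∑ V G.term} {ℂ.1#} (G.sumOver-term-zero d≈0)
      collapse (no _)    = ℂ.refl {∑ V G.term}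

    -- `T` inverts the lift in R, the Kloosterman sum inverts `v` in R/d^⊥. Inverses are unique, so
    -- the two agree modulo d^⊥, which the factor `d` does not see.
    term≈ : ∀ v → G.term v ℂ.≈ ⟦ d s * value v ⟧ ℂ.* ⟦ d s * (a₀ s * b₀ s * inverse v) ⟧
    term≈ v = ℂ.*-cong {⟦ d s * value (lift s v) ⟧} {⟦ d s * value v ⟧}
      {⟦ d s * (a₀ s * b₀ s) * inverse (lift s v) ⟧} {⟦ d s * (a₀ s * b₀ s * inverse v) ⟧}
      (⟦⟧-cong (∼⇒*≈* R (d s) (lift-mod s v)))
      (⟦⟧-cong (trans (x∙y*z (d s) _ _) (trans (*-congˡ (∼⇒*≈* R (d s) (inverse-lift v)))
        (sym (x∙yz≈y∙xz (d s) _ _)))))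
      where
      module Q = CommutativeRing (R/d^⊥ s)

      reduce : Unit R → Unit (R/d^⊥ s)
      reduce (unit u u⁻¹ p) = unit u u⁻¹ (≈⇒∼ R (_^⊥ R (d s)) p)

      inverse-lift : ∀ v → inverse (lift s v) Q.≈ inverse v
      inverse-lift v = AbelianGroup.⁻¹-cong (unitGroup (R/d^⊥ s)) {reduce (lift s v)} {v} (lift-mod s v)

      open CommutativeSemigroupProperties *-commutativeSemigroup using (x∙yz≈y∙xz)
      x∙y*z : ∀ x y z → x * y * z ≈ y * (x * z)
      x∙y*z x y z = trans (*-assoc x y z) (x∙yz≈y∙xz x y z)

    ∑-generators≈·T : ∑-generators a b D ℂ.≈ ∣d^⊥∣ s · T s
    ∑-generators≈·T = ℂ.trans {∑-generators a b D} {∣d^⊥∣ s · ∑ V G.term} {∣d^⊥∣ s · T s}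
      G.∑-generators≈∣d^⊥∣T
      (×-congʳ (∣d^⊥∣ s) {∑ V G.term} {T s} (ℂ.sym {T s} {∑ V G.term} T≈∑))

  isKloosterman : (D : PrincipalIdealAbove R a b) (s : Choice D) →
    IsKloosterman (T s) (R/d^⊥-finite s) (d s ∙⊥ ψ) ((a₀ s * b₀ s) ∙ (d s ∙⊥ ψ))
  isKloosterman D s = SummandsOf⇒IsKloosterman (R/d^⊥ s) (R/d^⊥-finite s) (quotientTerm D s) (T s) (T≈∑ D s)
    _ _ _ (≡.refl , term≈ D s)

  opaque
    unfolding IsKloosterman

    T≈Kloosterman : (D : PrincipalIdealAbove R a b) (s : Choice D) →
      T s ℂ.≈ Kloosterman (R/d^⊥-finite s) (d s ∙⊥ ψ) ((a₀ s * b₀ s) ∙ (d s ∙⊥ ψ))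
    T≈Kloosterman D s = isKloosterman D s

  module _ (D E : PrincipalIdealAbove R a b) (D≐E : Member (ideal D) ≐ Member (ideal E))
           (s : Choice D) (t : Choice E) where

    -- Generators of the same ideal divide each other, so each annihilator is contained in the
    -- other.
    ∣d^⊥∣-unique : ∣d^⊥∣ s ≡ ∣d^⊥∣ t
    ∣d^⊥∣-unique = ℕ.≤-antisym
      (^⊥-size-mono R fin (d s) (d t)
        (λ p → proj₁ (d-generates s) (proj₂ D≐E (proj₂ (d-generates t) p))))
      (^⊥-size-mono R fin (d t) (d s)
        (λ p → proj₁ (d-generates t) (proj₁ D≐E (proj₂ (d-generates s) p))))

    -- ∣d^⊥∣ T is a sum over all generators of the ideal, whatever the choices.
    T-unique : T s ℂ.≈ T t
    T-unique = ·-cancel ∣d^⊥∣-unique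
      (size-nonZero (^⊥-finite R fin (d s)) (0# , Ideal.0-closed (_^⊥ R (d s)))) (T s) (T t)
      (ℂ.trans {∣d^⊥∣ s · T s} {∑-generators a b D} {∣d^⊥∣ t · T t}
        (ℂ.sym {∑-generators a b D} {∣d^⊥∣ s · T s} (∑-generators≈·T D s))
        (ℂ.trans {∑-generators a b D} {∑-generators a b E} {∣d^⊥∣ t · T t}
          (∑-generators-cong a b D E D≐E) (∑-generators≈·T E t)))

  kloosterman≈∑·T : (choose : (D : PrincipalIdealAbove R a b) → Choice D) →
    ∑ (unitsFinite R fin) (λ u → ⟦ a * value u + b * inverse u ⟧) ℂ.≈
    ∑ (principalIdealAbove-finite R fin a b) (λ D → ∣d^⊥∣ (choose D) · T (choose D))
  kloosterman≈∑·T choose = kloosterman≈∑∑-generators a b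
    (λ D → ∣d^⊥∣ (choose D) · T (choose D)) (λ D → ∑-generators≈·T D (choose D))

  mainTheorem1 :
      ((D : PrincipalIdealAbove R a b) → Choice D)
    × ((D E : PrincipalIdealAbove R a b) → Member (ideal D) ≐ Member (ideal E) →
       (s : Choice D) (t : Choice E) →
       (T s ℂ.≈ T t) × (∣d^⊥∣ s ≡ ∣d^⊥∣ t))
    × ((D : PrincipalIdealAbove R a b) (s : Choice D) →
       Primitive (d s ∙⊥ ψ) ×
       (T s ℂ.≈ Kloosterman (R/d^⊥-finite s) (d s ∙⊥ ψ) ((a₀ s * b₀ s) ∙ (d s ∙⊥ ψ))))
    × ((D : PrincipalIdealAbove R a b) → Member (ideal D) ≐ Member (principal R 0#) →
       (a ≈ 0#) × (b ≈ 0#))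
    × ((choose : (D : PrincipalIdealAbove R a b) → Choice D) →
       ∑ (unitsFinite R fin) (λ u → ⟦ a * value u + b * inverse u ⟧)
       ℂ.≈
       ∑ (principalIdealAbove-finite R fin a b) (λ D → ∣d^⊥∣ (choose D) · T (choose D)))
  mainTheorem1 =
      choice
    , (λ D E D≐E s t → T-unique D E D≐E s t , ∣d^⊥∣-unique D E D≐E s t)
    , (λ D s → ∙⊥-primitive ψ prim (d s) , T≈Kloosterman D s)
    , (λ D (D⊆0 , _) → vanish (D⊆0 (above-a D (d∈principal R a)))
                     , vanish (D⊆0 (above-b D (d∈principal R b))))
    , kloosterman≈∑·T
    where
    open PrincipalIdealAbove using (above-a; above-b)
    vanish : ∀ {x} → Member (principal R 0#) x → x ≈ 0#
    vanish (t , x≈0t) = trans x≈0t (zeroˡ t)
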